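{- For all integers $n>6$, \[ \frac{p(n-1)}{p(n)}\left(1+\frac{240}{(24n)^{3/2}}\right) > \frac{p(n)}{p(n+1)}. \]
   Context: $p(n)$ denotes the number of integer partitions of $n$. -}

module Defs where

open import Data.Nat using (ℕ; zero; suc; _+_; _*_; _∸_; _≤?_)
open import Data.List using (upTo; map)
open import Data.Nat.ListAction using (sum)
open import Relation.Nullary.Decidable using (does)
open import Data.Bool using (if_then_else_)

-- partsAtMost k n = number of partitions of n into parts of size at most k.
-- Recursion on k: choose the multiplicity j of the part k (j * k ≤ n),
-- the rest is a partition of n ∸ j * k into parts of size at most k - 1.
partsAtMost : ℕ → ℕ → ℕ
partsAtMost zero zero = 1
partsAtMost zero (suc _) = 0
partsAtMost (suc k) n =
  sum (map (λ j → if does (j * suc k ≤? n)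
                    then partsAtMost k (n ∸ j * suc k)
                    else 0)
           (upTo (suc n)))

-- p n = number of integer partitions of n (parts are at most n).
p : ℕ → ℕ
p n = partsAtMost n n

{-# OPTIONS --safe #-}
module Submission where

-- Write M = Σ_{k≥1} p(n-k), Z = Σ_{k≥1} k p(n-k), and split n p(n) = Σ σ(k) p(n-k) as Z + Σ τ(k) p(n-k) with τ(k) = σ(k) - k.
-- If √(p(j-1) p(j+1)) ≥ (1 - f(j)) p(j) for j < n, then Cauchy–Schwarz in the form
-- √((a+a′)(c+c′)) ≥ √(ac) + √(a′c′), applied to n-1, n and n+1, gives
--   n √(p(n-1) p(n+1)) ≥ n p(n) - Σ τ(k) f(n-k) p(n-k) - (Z - √((Z-M)(Z+M+p(n)))).
-- Cauchy–Schwarz for the number of distinct part sizes of a partition of n gives M² ≤ p(n) (Z - Σ_{k≥1} p(n-2k)),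
-- so the last bracket is about p(n) M / (4Z).  The average order of σ yields Z ≥ (4/7) n p(n), and
-- with f(j) = j^(-3/2) the induction closes for n ≥ 2000, smaller n being checked by computation.
-- Finally p(n)² - p(n-1) p(n+1) ≤ 2 f(n) p(n)²  and  2 f(n) = 2 n^(-3/2) is smaller than 240/(24n)^(3/2) ≈ 2.04 n^(-3/2).

open import Defs
open import Data.Bool using (Bool; true; false; T; if_then_else_; _∧_; _∨_)
open import Data.Bool.Properties using (T-∧; T-∨)
open import Data.List using (List; []; _∷_; applyUpTo)
open import Data.List.Properties using (map-upTo)
open import Data.Nat
open import Data.Nat.DivMod
open import Data.Nat.ListAction using (sum)
open import Data.Nat.Properties
open import Data.Nat.Tactic.RingSolver using (solve-∀)
open import Data.Product using (_×_; _,_; ∃; proj₁; proj₂)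
open import Data.Sum using (_⊎_; inj₁; inj₂)
open import Data.Unit using (tt)
open import Function using (_∘_; id)
open import Function.Bundles using (module Equivalence)
open import Relation.Binary.PropositionalEquality
open import Relation.Nullary using (yes; no; ¬_; does; contradiction)
open import Relation.Nullary.Decidable using (toWitness)

-- Finite sums

-- The losses are compared with the budget n f(n) p(n), about p(n)/√n. Since Z ≥ (4/7) n p(n), the
-- weights τ carry at most 3/7 of n p(n); with f(n-k) ≤ (5/4) f(n) up to a quadratic correction they
-- cost 15/28 of the budget. The bracket costs 2/5, which leaves room for that correction and for
-- the terms with k > 3n/4. The subtracted Σ p(n-2k), about M/2, is decisive: from M² ≤ p(n) Z alone
-- the bracket would be about p(n) M / (2Z), a share of about 0.66 with the available bound on M/Z,
-- and the shares would exceed 1. Divisor sums are irregular, so σ and τ are bounded only in the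
-- mean; this suffices because p(n-k) is nonincreasing in k. No real numbers occur: a lower bound
-- for a square root is the relation `CS`, b² ≤ a c, and n^(-3/2) is represented by all rationals
-- a/b above it. The induction hypothesis is used only at n-k ≥ n/4, so an induction starting at
-- 2000 rests on a table for 500 ≤ n < 2000; below 500 the theorem itself is tested.

∑ : ℕ → (ℕ → ℕ) → ℕ
∑ zero f = 0
∑ (suc K) f = ∑ K f + f K

interchange : ∀ a b c d → (a + b) + (c + d) ≡ (a + c) + (b + d)
interchange = solve-∀

∑-cong< : ∀ K {f g} → (∀ k → k < K → f k ≡ g k) → ∑ K f ≡ ∑ K g
∑-cong< zero e = refl
∑-cong< (suc K) e = cong₂ _+_ (∑-cong< K λ k k<K → e k (m<n⇒m<1+n k<K)) (e K ≤-refl)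

∑-cong : ∀ K {f g} → (∀ k → f k ≡ g k) → ∑ K f ≡ ∑ K g
∑-cong K e = ∑-cong< K λ k _ → e k

∑-mono< : ∀ K {f g} → (∀ k → k < K → f k ≤ g k) → ∑ K f ≤ ∑ K g
∑-mono< zero e = z≤n
∑-mono< (suc K) e = +-mono-≤ (∑-mono< K λ k k<K → e k (m<n⇒m<1+n k<K)) (e K ≤-refl)

∑-mono : ∀ K {f g} → (∀ k → f k ≤ g k) → ∑ K f ≤ ∑ K g
∑-mono K e = ∑-mono< K λ k _ → e k

∑-+ : ∀ K f g → ∑ K (λ k → f k + g k) ≡ ∑ K f + ∑ K g
∑-+ zero f g = refl
∑-+ (suc K) f g = trans (cong (_+ (f K + g K)) (∑-+ K f g)) (interchange (∑ K f) (∑ K g) (f K) (g K))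

∑-*ˡ : ∀ K c f → ∑ K (λ k → c * f k) ≡ c * ∑ K f
∑-*ˡ zero c f = sym (*-zeroʳ c)
∑-*ˡ (suc K) c f = trans (cong (_+ c * f K) (∑-*ˡ K c f)) (sym (*-distribˡ-+ c (∑ K f) (f K)))

∑-*ʳ : ∀ K f c → ∑ K (λ k → f k * c) ≡ ∑ K f * c
∑-*ʳ zero f c = refl
∑-*ʳ (suc K) f c = trans (cong (_+ f K * c) (∑-*ʳ K f c)) (sym (*-distribʳ-+ c (∑ K f) (f K)))

∑-0 : ∀ K {f} → (∀ k → k < K → f k ≡ 0) → ∑ K f ≡ 0
∑-0 zero e = refl
∑-0 (suc K) e = cong₂ _+_ (∑-0 K λ k k<K → e k (m<n⇒m<1+n k<K)) (e K ≤-refl)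

∑-front : ∀ K f → ∑ (suc K) f ≡ f 0 + ∑ K (f ∘ suc)
∑-front zero f = +-comm 0 (f 0)
∑-front (suc K) f = trans (cong (_+ f (suc K)) (∑-front K f)) (+-assoc (f 0) _ _)

∑-swap : ∀ K L (f : ℕ → ℕ → ℕ) → ∑ K (λ k → ∑ L (f k)) ≡ ∑ L (λ l → ∑ K λ k → f k l)
∑-swap zero L f = sym (∑-0 L λ _ _ → refl)
∑-swap (suc K) L f = trans (cong (_+ ∑ L (f K)) (∑-swap K L f)) (sym (∑-+ L _ (f K)))

∑-extend : ∀ {K L} → K ≤ L → ∀ {f} → (∀ k → K ≤ k → f k ≡ 0) → ∑ L f ≡ ∑ K f
∑-extend {K} K≤L {f} e with ≤⇒≤′ K≤L
... | ≤′-refl = refl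
... | ≤′-step {L} K≤′L = trans (cong₂ _+_ (∑-extend (≤′⇒≤ K≤′L) e) (e L (≤′⇒≤ K≤′L))) (+-identityʳ _)

∑-monoˡ : ∀ {K L} → K ≤ L → ∀ f → ∑ K f ≤ ∑ L f
∑-monoˡ K≤L f with ≤⇒≤′ K≤L
... | ≤′-refl = ≤-refl
... | ≤′-step K≤′L = ≤-trans (∑-monoˡ (≤′⇒≤ K≤′L) f) (m≤m+n _ _)

-- Passing from `x` to `y` removes `B * (x - y)` on the left but only `A * (x - y)` on the right.
lower-multiplier : ∀ {A B X Y x y} → A ≤ B → y ≤ x → X + B * x ≤ Y + A * x → X + B * y ≤ Y + A * y
lower-multiplier {A} {B} {X} {Y} {x} {y} A≤B y≤x h with B ∸ A | m+[n∸m]≡n A≤B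
... | D | refl = begin
  X + (A + D) * y    ≡⟨ expand X A D y ⟩
  (X + D * y) + A * y ≤⟨ +-monoˡ-≤ (A * y) (+-monoʳ-≤ X (*-monoʳ-≤ D y≤x)) ⟩
  (X + D * x) + A * y ≤⟨ +-monoˡ-≤ (A * y) (+-cancelʳ-≤ (A * x) _ _ (subst (_≤ Y + A * x) (expand X A D x) h)) ⟩
  Y + A * y ∎
  where
  open ≤-Reasoning
  expand : ∀ X A D y → X + (A + D) * y ≡ (X + D * y) + A * y
  expand = solve-∀

abel : ∀ (α β x : ℕ → ℕ) → (∀ k → x (suc k) ≤ x k) → (∀ K → ∑ K α ≤ ∑ K β) →
  ∀ K → ∑ K (λ k → α k * x k) ≤ ∑ K (λ k → β k * x k)
abel α β x anti A≤B zero = z≤n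
abel α β x anti A≤B (suc K) =
  subst₂ _≤_ (cancel₀ _ (∑ (suc K) β)) (cancel₀ _ (∑ (suc K) α)) (lower-multiplier (A≤B (suc K)) z≤n (go K))
  where
  cancel₀ : ∀ X B → X + B * 0 ≡ X
  cancel₀ = solve-∀
  add-term : ∀ X B a b t → (X + B * t) + (a * t + b * t) ≡ (X + a * t) + (B + b) * t
  add-term = solve-∀
  add-term′ : ∀ X B a b t → (X + B * t) + (a * t + b * t) ≡ (X + b * t) + (B + a) * t
  add-term′ = solve-∀
  -- Subtraction-free form of Σ (β - α) x ≥ (Σ (β - α)) x(K), the invariant of Abel summation; the
  -- multiplier x(K) is finally lowered to 0.
  go : ∀ K → ∑ (suc K) (λ k → α k * x k) + ∑ (suc K) β * x K ≤ ∑ (suc K) (λ k → β k * x k) + ∑ (suc K) α * x K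
  go zero = ≤-reflexive (+-comm (α 0 * x 0) (β 0 * x 0))
  go (suc K) = subst₂ _≤_
    (add-term (∑ (suc K) (λ k → α k * x k)) (∑ (suc K) β) (α (suc K)) (β (suc K)) (x (suc K)))
    (add-term′ (∑ (suc K) (λ k → β k * x k)) (∑ (suc K) α) (α (suc K)) (β (suc K)) (x (suc K)))
    (+-monoˡ-≤ _ (lower-multiplier (A≤B (suc K)) (anti K) (go K)))

-- Shifted sequences and convolutions

-- Multiplication of the generating function by q^k. The value is 0 for n < k, where f (n ∸ k) would
-- wrongly return f 0.
sh : ℕ → (ℕ → ℕ) → ℕ → ℕ
sh zero f n = f n
sh (suc k) f zero = 0
sh (suc k) f (suc n) = sh k f n

sh-< : ∀ {k n} f → n < k → sh k f n ≡ 0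
sh-< {suc k} {zero} f n<k = refl
sh-< {suc k} {suc n} f n<k = sh-< f (s≤s⁻¹ n<k)

sh-+ : ∀ k m f → sh k f (k + m) ≡ f m
sh-+ zero m f = refl
sh-+ (suc k) m f = sh-+ k m f

sh-cong : ∀ k {f g} n → (∀ m → m ≤ n → f m ≡ g m) → sh k f n ≡ sh k g n
sh-cong zero n e = e n ≤-refl
sh-cong (suc k) zero e = refl
sh-cong (suc k) (suc n) e = sh-cong k n λ m m≤n → e m (m≤n⇒m≤1+n m≤n)

sh-add : ∀ k f g n → sh k (λ m → f m + g m) n ≡ sh k f n + sh k g n
sh-add zero f g n = refl
sh-add (suc k) f g zero = refl
sh-add (suc k) f g (suc n) = sh-add k f g n

sh-∑ : ∀ k K (f : ℕ → ℕ → ℕ) n → sh k (λ m → ∑ K (λ i → f i m)) n ≡ ∑ K (λ i → sh k (f i) n)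
sh-∑ k zero f n = sh-0 k n
  where
  sh-0 : ∀ k n → sh k (λ _ → 0) n ≡ 0
  sh-0 zero n = refl
  sh-0 (suc k) zero = refl
  sh-0 (suc k) (suc n) = sh-0 k n
sh-∑ k (suc K) f n = trans (sh-add k _ (f K) n) (cong (_+ sh k (f K) n) (sh-∑ k K f n))

sh-*ˡ : ∀ k c f n → sh k (λ m → c * f m) n ≡ c * sh k f n
sh-*ˡ zero c f n = refl
sh-*ˡ (suc k) c f zero = sym (*-zeroʳ c)
sh-*ˡ (suc k) c f (suc n) = sh-*ˡ k c f n

sh-sh : ∀ k l f n → sh k (sh l f) n ≡ sh (k + l) f n
sh-sh zero l f n = refl
sh-sh (suc k) l f zero = refl
sh-sh (suc k) l f (suc n) = sh-sh k l f n

sh-comm : ∀ k l f n → sh k (sh l f) n ≡ sh l (sh k f) n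
sh-comm k l f n = trans (sh-sh k l f n) (trans (cong (λ i → sh i f n) (+-comm k l)) (sym (sh-sh l k f n)))

-- Product rule for the operator q d/dq applied to q^k F(q).
sh-* : ∀ k f n → n * sh k f n ≡ sh k (λ m → m * f m) n + k * sh k f n
sh-* zero f n = sym (+-identityʳ _)
sh-* (suc k) f zero = sym (*-zeroʳ k)
sh-* (suc k) f (suc n) = trans (cong (sh k f n +_) (sh-* k f n)) (swap (sh k f n) (sh k (λ m → m * f m) n) (k * sh k f n))
  where
  swap : ∀ a b c → a + (b + c) ≡ b + (a + c)
  swap = solve-∀

sh-mono : ∀ k {f} → (∀ n → f n ≤ f (suc n)) → ∀ n → sh k f n ≤ sh k f (suc n)
sh-mono zero mono n = mono n
sh-mono (suc k) mono zero = z≤n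
sh-mono (suc k) mono (suc n) = sh-mono k mono n

sh-anti : ∀ k {f} → (∀ n → f n ≤ f (suc n)) → ∀ n → sh (suc k) f n ≤ sh k f n
sh-anti k mono zero = z≤n
sh-anti zero mono (suc n) = mono n
sh-anti (suc k) mono (suc n) = sh-anti k mono n

sh-≤ : ∀ k {f g} n → (∀ m → m ≤ n → f m ≤ g m) → sh k f n ≤ sh k g n
sh-≤ zero n e = e n ≤-refl
sh-≤ (suc k) zero e = z≤n
sh-≤ (suc k) (suc n) e = sh-≤ k n λ m m≤n → e m (m≤n⇒m≤1+n m≤n)

infixl 7 _⋆_
_⋆_ : (ℕ → ℕ) → (ℕ → ℕ) → ℕ → ℕ
(w ⋆ f) n = ∑ (suc n) (λ k → w k * sh k f n)

⋆-extend : ∀ w f {n K} → n < K → ∑ K (λ k → w k * sh k f n) ≡ (w ⋆ f) n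
⋆-extend w f {n} n<K = ∑-extend n<K λ k n<k → trans (cong (w k *_) (sh-< f n<k)) (*-zeroʳ (w k))

⋆-suc : ∀ w f n → (w ⋆ f) (suc n) ≡ w 0 * f (suc n) + ((w ∘ suc) ⋆ f) n
⋆-suc w f n = ∑-front (suc n) (λ k → w k * sh k f (suc n))

⋆-congˡ : ∀ {v w} f n → (∀ k → v k ≡ w k) → (v ⋆ f) n ≡ (w ⋆ f) n
⋆-congˡ f n e = ∑-cong (suc n) λ k → cong (_* sh k f n) (e k)

⋆-+ˡ : ∀ v w f n → ((λ k → v k + w k) ⋆ f) n ≡ (v ⋆ f) n + (w ⋆ f) n
⋆-+ˡ v w f n = trans (∑-cong (suc n) λ k → *-distribʳ-+ (sh k f n) (v k) (w k)) (∑-+ (suc n) _ _)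

⋆-*ˡ : ∀ c w f n → ((λ k → c * w k) ⋆ f) n ≡ c * (w ⋆ f) n
⋆-*ˡ c w f n = trans (∑-cong (suc n) λ k → *-assoc c (w k) _) (∑-*ˡ (suc n) c _)

-- Turns bounds on the mean of an arithmetic weight into bounds on its convolution with p.
⋆-abel : ∀ v w {f} → (∀ n → f n ≤ f (suc n)) → (∀ K → ∑ K v ≤ ∑ K w) → ∀ n → (v ⋆ f) n ≤ (w ⋆ f) n
⋆-abel v w {f} mono V≤W n = abel v w (λ k → sh k f n) (λ k → sh-anti k mono n) V≤W (suc n)

-- Iterated partial sums:  pre f n = Σ_{k≥1} f(n-k)  and  pre (pre f) (suc n) = Σ_{k≥1} k f(n-k).

pre : (ℕ → ℕ) → ℕ → ℕ
pre f n = ∑ n f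

∑-sh-suc : ∀ f n {K} → n ≤ K → ∑ K (λ k → sh (suc k) f n) ≡ pre f n
∑-sh-suc f zero {K} _ = ∑-0 K λ _ _ → refl
∑-sh-suc f (suc n) {suc K} (s≤s n≤K) =
  trans (∑-front K (λ k → sh k f n)) (trans (cong (f n +_) (∑-sh-suc f n n≤K)) (+-comm (f n) _))

1⋆ : ∀ f n → ((λ _ → 1) ⋆ f) n ≡ pre f (suc n)
1⋆ f zero = cong (0 +_) (+-identityʳ (f 0))
1⋆ f (suc n) = trans (⋆-suc (λ _ → 1) f n) (trans (cong₂ _+_ (+-identityʳ (f (suc n))) (1⋆ f n)) (+-comm (f (suc n)) _))

k⋆ : ∀ f n → (id ⋆ f) n ≡ pre (pre f) (suc n)
k⋆ f zero = refl
k⋆ f (suc n) = trans (⋆-suc id f n) (trans (⋆-+ˡ (λ _ → 1) id f n) (trans (cong₂ _+_ (1⋆ f n) (k⋆ f n)) (+-comm (pre f (suc n)) _)))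

k²⋆ : ∀ f n → ((λ k → k * k) ⋆ f) n ≡ 2 * pre (λ m → pre (pre f) (suc m)) n + pre (pre f) (suc n)
k²⋆ f zero = refl
k²⋆ f (suc n) = begin
  ((λ k → k * k) ⋆ f) (suc n)
    ≡⟨ ⋆-suc (λ k → k * k) f n ⟩
  ((λ k → suc k * suc k) ⋆ f) n
    ≡⟨ ⋆-congˡ f n square ⟩
  ((λ k → k * k + (2 * k + 1)) ⋆ f) n
    ≡⟨ trans (⋆-+ˡ (λ k → k * k) _ f n) (cong (((λ k → k * k) ⋆ f) n +_) (trans (⋆-+ˡ (2 *_) _ f n) (cong (_+ ((λ _ → 1) ⋆ f) n) (⋆-*ˡ 2 id f n)))) ⟩
  ((λ k → k * k) ⋆ f) n + (2 * (id ⋆ f) n + ((λ _ → 1) ⋆ f) n)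
    ≡⟨ cong₂ _+_ (k²⋆ f n) (cong₂ (λ u v → 2 * u + v) (k⋆ f n) (1⋆ f n)) ⟩
  (2 * A + Z) + (2 * Z + M)
    ≡⟨ regroup A Z M ⟩
  2 * (A + Z) + (Z + M) ∎
  where
  open ≡-Reasoning
  M = pre f (suc n)
  Z = pre (pre f) (suc n)
  A = pre (λ m → pre (pre f) (suc m)) n
  square : ∀ k → suc k * suc k ≡ k * k + (2 * k + 1)
  square = solve-∀
  regroup : ∀ A Z M → (2 * A + Z) + (2 * Z + M) ≡ 2 * (A + Z) + (Z + M)
  regroup = solve-∀

-- Iterated prefix sums carry binomial weights: here k³ = 6 C(k+1,3) + k, just as k² = 2 C(k,2) + k
-- in `k²⋆`.
k³⋆ : ∀ f n → ((λ k → k * k * k) ⋆ f) n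
  ≡ 6 * pre (pre (λ m → pre (pre f) (suc m))) (suc n) + pre (pre f) (suc n)
k³⋆ f zero = refl
k³⋆ f (suc n) = begin
  ((λ k → k * k * k) ⋆ f) (suc n)
    ≡⟨ ⋆-suc (λ k → k * k * k) f n ⟩
  ((λ k → suc k * suc k * suc k) ⋆ f) n
    ≡⟨ ⋆-congˡ f n cube ⟩
  ((λ k → k * k * k + (3 * (k * k) + (3 * k + 1))) ⋆ f) n
    ≡⟨ trans (⋆-+ˡ (λ k → k * k * k) _ f n) (cong (((λ k → k * k * k) ⋆ f) n +_)
        (trans (⋆-+ˡ (λ k → 3 * (k * k)) _ f n) (cong₂ _+_ (⋆-*ˡ 3 (λ k → k * k) f n)
          (trans (⋆-+ˡ (3 *_) _ f n) (cong (_+ ((λ _ → 1) ⋆ f) n) (⋆-*ˡ 3 id f n)))))) ⟩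
  ((λ k → k * k * k) ⋆ f) n + (3 * ((λ k → k * k) ⋆ f) n + (3 * (id ⋆ f) n + ((λ _ → 1) ⋆ f) n))
    ≡⟨ cong₂ _+_ (k³⋆ f n) (cong₂ (λ u v → 3 * u + v) (k²⋆ f n) (cong₂ (λ u v → 3 * u + v) (k⋆ f n) (1⋆ f n))) ⟩
  (6 * B + Z) + (3 * (2 * A + Z) + (3 * Z + M))
    ≡⟨ regroup A B Z M ⟩
  6 * (B + (A + Z)) + (Z + M) ∎
  where
  open ≡-Reasoning
  M = pre f (suc n)
  Z = pre (pre f) (suc n)
  A = pre (λ m → pre (pre f) (suc m)) n
  B = pre (pre (λ m → pre (pre f) (suc m))) (suc n)
  cube : ∀ k → suc k * suc k * suc k ≡ k * k * k + (3 * (k * k) + (3 * k + 1))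
  cube = solve-∀
  regroup : ∀ A B Z M → (6 * B + Z) + (3 * (2 * A + Z) + (3 * Z + M)) ≡ 6 * (B + (A + Z)) + (Z + M)
  regroup = solve-∀

-- Recursion for the number of partitions with bounded parts

sum-applyUpTo : ∀ f n → sum (applyUpTo f n) ≡ ∑ n f
sum-applyUpTo f zero = refl
sum-applyUpTo f (suc n) = trans (cong (f 0 +_) (sum-applyUpTo (f ∘ suc) n)) (sym (∑-front n f))

sh-∸ : ∀ k f n → (if does (k ≤? n) then f (n ∸ k) else 0) ≡ sh k f n
sh-∸ k f n with k ≤ᵇ n in eq
... | true  = trans (sym (sh-+ k (n ∸ k) f)) (cong (sh k f) (m+[n∸m]≡n (≤ᵇ⇒≤ k n (subst T (sym eq) tt))))
... | false = sym (sh-< {k} {n} f (≰⇒> λ k≤n → subst T eq (≤⇒≤ᵇ {k} {n} k≤n)))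

partsAtMost-∑ : ∀ K n → partsAtMost (suc K) n ≡ ∑ (suc n) (λ j → sh (j * suc K) (partsAtMost K) n)
partsAtMost-∑ K n = trans (cong sum (map-upTo _ (suc n)))
  (trans (sum-applyUpTo _ (suc n)) (∑-cong (suc n) λ j → sh-∸ (j * suc K) (partsAtMost K) n))

-- Partitions that contain the part K+1 at least once: one copy is removed and the remaining
-- multiplicities are summed again.
∑-sh-multiples : ∀ K n →
  ∑ n (λ j → sh (suc j * suc K) (partsAtMost K) n) ≡ sh (suc K) (partsAtMost (suc K)) n
∑-sh-multiples K zero = refl
∑-sh-multiples K (suc n) = begin
  ∑ (suc n) (λ j → sh (K + j * suc K) f n)
    ≡⟨ ∑-cong (suc n) (λ j → sym (sh-sh K (j * suc K) f n)) ⟩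
  ∑ (suc n) (λ j → sh K (sh (j * suc K) f) n)
    ≡⟨ sym (sh-∑ K (suc n) (λ j → sh (j * suc K) f) n) ⟩
  sh K (λ m → ∑ (suc n) (λ j → sh (j * suc K) f m)) n
    ≡⟨ sh-cong K n (λ m m≤n → trans (∑-extend (s≤s m≤n) (λ j m<j → sh-< f (≤-trans m<j (m≤m*n j (suc K))))) (sym (partsAtMost-∑ K m))) ⟩
  sh K (partsAtMost (suc K)) n ∎
  where
  open ≡-Reasoning
  f = partsAtMost K

partsAtMost-rec : ∀ K n → partsAtMost (suc K) n ≡ partsAtMost K n + sh (suc K) (partsAtMost (suc K)) n
partsAtMost-rec K n = trans (partsAtMost-∑ K n)
  (trans (∑-front n _) (cong (partsAtMost K n +_) (∑-sh-multiples K n)))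

partsAtMost-p : ∀ {K n} → n ≤ K → partsAtMost K n ≡ p n
partsAtMost-p n≤K with ≤⇒≤′ n≤K
... | ≤′-refl = refl
partsAtMost-p {suc K} {n} n≤K | ≤′-step n≤′K =
  trans (partsAtMost-rec K n)
    (trans (cong₂ _+_ (partsAtMost-p (≤′⇒≤ n≤′K)) (sh-< (partsAtMost (suc K)) (s≤s (≤′⇒≤ n≤′K)))) (+-identityʳ (p n)))

-- Starts at `suc K` because a part 1 must be available: `partsAtMost 0` drops from 1 to 0.
partsAtMost-mono : ∀ K n → partsAtMost (suc K) n ≤ partsAtMost (suc K) (suc n)
partsAtMost-mono zero n = ≤-reflexive (sym (partsAtMost-rec 0 (suc n)))
partsAtMost-mono (suc K) n = subst₂ _≤_ (sym (partsAtMost-∑ (suc K) n)) (sym (partsAtMost-∑ (suc K) (suc n)))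
  (≤-trans (∑-mono (suc n) λ j → sh-mono (j * suc (suc K)) (partsAtMost-mono K) n) (m≤m+n _ _))

p-mono-suc : ∀ n → p n ≤ p (suc n)
p-mono-suc n = subst (_≤ p (suc n)) (partsAtMost-p (n≤1+n n)) (partsAtMost-mono n n)

p-mono : ∀ {m n} → m ≤ n → p m ≤ p n
p-mono m≤n with ≤⇒≤′ m≤n
... | ≤′-refl = ≤-refl
... | ≤′-step {n} m≤′n = ≤-trans (p-mono (≤′⇒≤ m≤′n)) (p-mono-suc n)

-- The equation u = r + q^(K+1) u determines the coefficients one after another; the bound `B`
-- allows for equations that hold only up to a truncation degree.
sh-fixpoint-unique : ∀ K B {u v r : ℕ → ℕ} →
  (∀ n → n ≤ B → u n ≡ r n + sh (suc K) u n) → (∀ n → n ≤ B → v n ≡ r n + sh (suc K) v n) →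
  ∀ n → n ≤ B → u n ≡ v n
sh-fixpoint-unique K B {u} {v} {r} eu ev n = go n n ≤-refl
  where
  go : ∀ b n → n ≤ b → n ≤ B → u n ≡ v n
  go b zero _ 0≤B = trans (eu 0 0≤B) (sym (ev 0 0≤B))
  go (suc b) (suc n) (s≤s n≤b) n<B = trans (eu (suc n) n<B) (trans
    (cong (r (suc n) +_) (sh-cong K n λ m m≤n → go b m (≤-trans m≤n n≤b) (≤-trans m≤n (<⇒≤ n<B))))
    (sym (ev (suc n) n<B)))

module _ (B : ℕ) where
  -- Coefficients of f(q) q^(i+1) / (1 - q^(i+1)), correct up to degree `B`.
  multiples : ℕ → (ℕ → ℕ) → ℕ → ℕ
  multiples i f n = ∑ B (λ j → sh (suc j * suc i) f n)

  -- Logarithmic differentiation of ∏ 1/(1-qⁱ).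
  n*partsAtMost : ∀ K n → n ≤ B → n * partsAtMost K n ≡ ∑ K (λ i → suc i * multiples i (partsAtMost K) n)
  n*partsAtMost zero zero _ = refl
  n*partsAtMost zero (suc n) _ = *-zeroʳ (suc n)
  n*partsAtMost (suc K) = sh-fixpoint-unique K B eq-u eq-v
    where
    κ = suc K
    f = partsAtMost K
    P = partsAtMost κ
    -- Source term of the equation u = r + q^κ u, which both sides of the claim satisfy.
    r : ℕ → ℕ
    r n = n * f n + κ * sh κ P n
    v : ℕ → ℕ
    v n = ∑ κ (λ i → suc i * multiples i P n)
    open ≡-Reasoning
    regroup : ∀ a b c → a + (b + c) ≡ (a + c) + b
    regroup = solve-∀
    eq-u : ∀ n → n ≤ B → n * P n ≡ r n + sh κ (λ m → m * P m) n
    eq-u n _ = begin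
      n * P n                     ≡⟨ cong (n *_) (partsAtMost-rec K n) ⟩
      n * (f n + sh κ P n)        ≡⟨ *-distribˡ-+ n (f n) _ ⟩
      n * f n + n * sh κ P n      ≡⟨ cong (n * f n +_) (sh-* κ P n) ⟩
      n * f n + (sh κ (λ m → m * P m) n + κ * sh κ P n)
                                  ≡⟨ regroup (n * f n) _ (κ * sh κ P n) ⟩
      r n + sh κ (λ m → m * P m) n ∎
    multiples-rec : ∀ i n → multiples i P n ≡ multiples i f n + sh κ (multiples i P) n
    multiples-rec i n = begin
      ∑ B (λ j → sh (suc j * suc i) P n)
        ≡⟨ ∑-cong B (λ j → trans (sh-cong (suc j * suc i) n (λ m _ → partsAtMost-rec K m))
             (trans (sh-add (suc j * suc i) f (sh κ P) n) (cong (sh (suc j * suc i) f n +_) (sh-comm (suc j * suc i) κ P n)))) ⟩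
      ∑ B (λ j → sh (suc j * suc i) f n + sh κ (sh (suc j * suc i) P) n)
        ≡⟨ ∑-+ B _ _ ⟩
      multiples i f n + ∑ B (λ j → sh κ (sh (suc j * suc i) P) n)
        ≡⟨ cong (multiples i f n +_) (sym (sh-∑ κ B (λ j → sh (suc j * suc i) P) n)) ⟩
      multiples i f n + sh κ (multiples i P) n ∎
    multiples-last : ∀ n → n ≤ B → multiples K f n ≡ sh κ P n
    multiples-last n n≤B = trans
      (∑-extend n≤B λ j n≤j → sh-< f (≤-trans (s≤s n≤j) (m≤m*n (suc j) κ)))
      (∑-sh-multiples K n)
    eq-v : ∀ n → n ≤ B → v n ≡ r n + sh κ v n
    eq-v n n≤B = begin
      v n
        ≡⟨ ∑-cong κ (λ i → trans (cong (suc i *_) (multiples-rec i n)) (trans (*-distribˡ-+ (suc i) (multiples i f n) _)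
             (cong (suc i * multiples i f n +_) (sym (sh-*ˡ κ (suc i) (multiples i P) n))))) ⟩
      ∑ κ (λ i → suc i * multiples i f n + sh κ (λ m → suc i * multiples i P m) n)
        ≡⟨ trans (∑-+ κ _ _) (cong (∑ κ (λ i → suc i * multiples i f n) +_) (sym (sh-∑ κ κ (λ i m → suc i * multiples i P m) n))) ⟩
      (∑ K (λ i → suc i * multiples i f n) + κ * multiples K f n) + sh κ v n
        ≡⟨ cong (_+ sh κ v n) (cong₂ _+_ (sym (n*partsAtMost K n n≤B)) (cong (κ *_) (multiples-last n n≤B))) ⟩
      r n + sh κ v n ∎

n*p : ∀ {B} n → n ≤ B → n * p n ≡ ∑ B (λ i → ∑ B (λ j → suc i * sh (suc j * suc i) p n))
n*p {B} n n≤B = begin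
  n * p n                 ≡⟨ cong (n *_) (sym (partsAtMost-p n≤B)) ⟩
  n * partsAtMost B n     ≡⟨ n*partsAtMost B B n n≤B ⟩
  ∑ B (λ i → suc i * multiples B i (partsAtMost B) n)
    ≡⟨ ∑-cong B (λ i → trans (sym (∑-*ˡ B (suc i) _)) (∑-cong B λ j → cong (suc i *_)
         (sh-cong (suc j * suc i) n λ m m≤n → partsAtMost-p (≤-trans m≤n n≤B)))) ⟩
  ∑ B (λ i → ∑ B (λ j → suc i * sh (suc j * suc i) p n)) ∎
  where open ≡-Reasoning

-- Cauchy–Schwarz as closure under addition of the relation  b² ≤ a c

record CS (a b c : ℕ) : Set where
  constructor cs
  field b²≤ac : b * b ≤ a * c

sq-cancel-≤ : ∀ {x y} → x * x ≤ y * y → x ≤ y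
sq-cancel-≤ {x} {y} h with x ≤? y
... | yes x≤y = x≤y
... | no  x≰y = contradiction h (<⇒≱ (*-mono-< (≰⇒> x≰y) (≰⇒> x≰y)))

4xy≤[x+y]² : ∀ x y → 4 * (x * y) ≤ (x + y) * (x + y)
4xy≤[x+y]² x y with ≤-total x y
... | inj₁ x≤y with y ∸ x | m+[n∸m]≡n x≤y
...   | d | refl = subst (4 * (x * (x + d)) ≤_) (sym (expand x d)) (m≤m+n _ (d * d))
  where
  expand : ∀ x d → (x + (x + d)) * (x + (x + d)) ≡ 4 * (x * (x + d)) + d * d
  expand = solve-∀
4xy≤[x+y]² x y | inj₂ y≤x with x ∸ y | m+[n∸m]≡n y≤x
...   | d | refl = subst (4 * ((y + d) * y) ≤_) (sym (expand y d)) (m≤m+n _ (d * d))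
  where
  expand : ∀ y d → ((y + d) + y) * ((y + d) + y) ≡ 4 * ((y + d) * y) + d * d
  expand = solve-∀

2x≤y+z : ∀ {x y z} → CS y x z → 2 * x ≤ y + z
2x≤y+z {x} {y} {z} (cs h) = sq-cancel-≤ (begin
  2 * x * (2 * x)    ≡⟨ square x ⟩
  4 * (x * x)        ≤⟨ *-monoʳ-≤ 4 h ⟩
  4 * (y * z)        ≤⟨ 4xy≤[x+y]² y z ⟩
  (y + z) * (y + z)  ∎)
  where
  open ≤-Reasoning
  square : ∀ x → 2 * x * (2 * x) ≡ 4 * (x * x)
  square = solve-∀

-- The mixed terms `a * c′` and `a′ * c` have product at least (b b′)², so by the
-- arithmetic-geometric mean inequality their sum covers 2 b b′.
CS-add : ∀ {a b c a′ b′ c′} → CS a b c → CS a′ b′ c′ → CS (a + a′) (b + b′) (c + c′)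
CS-add {a} {b} {c} {a′} {b′} {c′} (cs h) (cs h′) = cs (begin
  (b + b′) * (b + b′)                          ≡⟨ expand b b′ ⟩
  b * b + b′ * b′ + 2 * (b * b′)               ≤⟨ +-mono-≤ (+-mono-≤ h h′) (2x≤y+z cross) ⟩
  a * c + a′ * c′ + (a * c′ + a′ * c)          ≡⟨ collect a a′ c c′ ⟩
  (a + a′) * (c + c′)                          ∎)
  where
  open ≤-Reasoning
  expand : ∀ b b′ → (b + b′) * (b + b′) ≡ b * b + b′ * b′ + 2 * (b * b′)
  expand = solve-∀
  collect : ∀ a a′ c c′ → a * c + a′ * c′ + (a * c′ + a′ * c) ≡ (a + a′) * (c + c′)
  collect = solve-∀
  cross : CS (a * c′) (b * b′) (a′ * c)
  cross = cs (subst₂ _≤_ (swap b b b′ b′) (swap′ a c a′ c′) (*-mono-≤ h h′))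
    where
    swap : ∀ a b c d → (a * b) * (c * d) ≡ (a * c) * (b * d)
    swap = solve-∀
    swap′ : ∀ a c a′ c′ → (a * c) * (a′ * c′) ≡ (a * c′) * (a′ * c)
    swap′ = solve-∀

CS-scale : ∀ k {a b c} → CS a b c → CS (k * a) (k * b) (k * c)
CS-scale k {a} {b} {c} (cs h) = cs (subst₂ _≤_ (swap k b b) (swap k a c) (*-monoʳ-≤ (k * k) h))
  where
  swap : ∀ k a c → k * k * (a * c) ≡ k * a * (k * c)
  swap = solve-∀

CS-∑ : ∀ K {a b c : ℕ → ℕ} → (∀ k → k < K → CS (a k) (b k) (c k)) → CS (∑ K a) (∑ K b) (∑ K c)
CS-∑ zero h = cs z≤n
CS-∑ (suc K) h = CS-add (CS-∑ K λ k k<K → h k (m<n⇒m<1+n k<K)) (h K ≤-refl)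

CS-sh : ∀ k n {a b c : ℕ → ℕ} → (∀ m → m ≤ n → CS (a m) (b m) (c m)) → CS (sh k a n) (sh k b n) (sh k c n)
CS-sh zero n h = h n ≤-refl
CS-sh (suc k) zero h = cs z≤n
CS-sh (suc k) (suc n) h = CS-sh k n λ m m≤n → h m (m≤n⇒m≤1+n m≤n)

-- If b and c are the first two moments of X on a set of size a, this is the step from X to X + 1.
CS-translate : ∀ {a b c} → CS a b c → CS a (b + a) (c + 2 * b + a)
CS-translate {a} {b} {c} (cs h) = cs (begin
  (b + a) * (b + a)            ≡⟨ expand a b ⟩
  b * b + (2 * b + a) * a      ≤⟨ +-monoˡ-≤ _ h ⟩
  a * c + (2 * b + a) * a      ≡⟨ collect a b c ⟩
  a * (c + 2 * b + a)          ∎)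
  where
  open ≤-Reasoning
  expand : ∀ a b → (b + a) * (b + a) ≡ b * b + (2 * b + a) * a
  expand = solve-∀
  collect : ∀ a b c → a * c + (2 * b + a) * a ≡ a * (c + 2 * b + a)
  collect = solve-∀

-- Moments of the number of distinct part sizes: first K counts pairs (partition, part size),
-- off K counts partitions with an ordered pair of two different part sizes.

first : ℕ → (ℕ → ℕ) → ℕ → ℕ
first K f n = ∑ K (λ k → sh (suc k) f n)

off : ℕ → (ℕ → ℕ) → ℕ → ℕ
off zero f n = 0
off (suc K) f n = off K f n + 2 * sh (suc K) (first K f) n

module _ (κ : ℕ) {f P : ℕ → ℕ} (rec : ∀ n → P n ≡ f n + sh κ P n) where
  open ≡-Reasoning

  -- Shifts, `first` and `off` are linear in the sequence and commute with q^κ, so each inherits the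
  -- recursion P = f + q^κ P.
  sh-rec : ∀ l n → sh l P n ≡ sh l f n + sh κ (sh l P) n
  sh-rec l n = trans (sh-cong l n (λ m _ → rec m))
    (trans (sh-add l f (sh κ P) n) (cong (sh l f n +_) (sh-comm l κ P n)))

  first-rec : ∀ K n → first K P n ≡ first K f n + sh κ (first K P) n
  first-rec K n = trans (∑-cong K λ k → sh-rec (suc k) n)
    (trans (∑-+ K _ _) (cong (first K f n +_) (sym (sh-∑ κ K (λ k → sh (suc k) P) n))))

  off-rec : ∀ K n → off K P n ≡ off K f n + sh κ (off K P) n
  off-rec zero n = sym (sh-∑ κ 0 (λ _ _ → 0) n)
  off-rec (suc K) n = begin
    off K P n + 2 * sh (suc K) (first K P) n
      ≡⟨ cong₂ (λ x y → x + 2 * y) (off-rec K n) (trans (sh-cong (suc K) n λ m _ → first-rec K m)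
           (trans (sh-add (suc K) (first K f) _ n) (cong (sh (suc K) (first K f) n +_) (sh-comm (suc K) κ (first K P) n)))) ⟩
    (a + b) + 2 * (c + d)
      ≡⟨ regroup a b c d ⟩
    (a + 2 * c) + (b + 2 * d)
      ≡⟨ cong ((a + 2 * c) +_) (sym (trans (sh-add κ (off K P) _ n) (cong (b +_) (sh-*ˡ κ 2 (sh (suc K) (first K P)) n)))) ⟩
    (a + 2 * c) + sh κ (off (suc K) P) n ∎
    where
    a = off K f n
    b = sh κ (off K P) n
    c = sh (suc K) (first K f) n
    d = sh κ (sh (suc K) (first K P)) n
    regroup : ∀ a b c d → (a + b) + 2 * (c + d) ≡ (a + 2 * c) + (b + 2 * d)
    regroup = solve-∀

-- With X the number of distinct part sizes up to K, `first` is ΣX and `off` is ΣX(X-1), so the last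
-- entry is ΣX² and the relation is (ΣX)² ≤ (Σ1)(ΣX²).
Moments : ℕ → (ℕ → ℕ) → ℕ → Set
Moments K f n = CS (f n) (first K f n) (first K f n + off K f n)

-- Partitions without the part κ = K+1 are covered by induction. In the others one copy of κ is
-- removed, and X is 1 plus the number of sizes up to K in the rest; hence the translation by 1.
moments : ∀ K n → Moments K (partsAtMost K) n
moments zero n = cs z≤n
moments (suc K) n = subst₂ (λ b c → CS (P n) b c) (sym eq-b) (sym eq-c)
  (subst (λ a → CS a (first K f n + sh κ b₁ n) ((first K f n + off K f n) + sh κ c₁ n)) (sym (partsAtMost-rec K n))
    (CS-add (moments K n) (CS-sh κ n λ m _ → CS-translate (below m))))
  where
  κ = suc K
  f = partsAtMost K
  P = partsAtMost κ
  rec = partsAtMost-rec K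
  b₁ c₁ : ℕ → ℕ
  b₁ m = first K P m + P m
  c₁ m = (first K P m + off K P m) + 2 * first K P m + P m

  step : ∀ n → CS (sh κ P n) (sh κ (first K P) n) (sh κ (λ m → first K P m + off K P m) n) → Moments K P n
  step n h = subst₂ (CS (P n)) (sym (first-rec κ rec K n))
    (sym (trans (cong₂ _+_ (first-rec κ rec K n) (off-rec κ rec K n))
      (trans (interchange (first K f n) _ (off K f n) _) (cong ((first K f n + off K f n) +_) (sym (sh-add κ (first K P) (off K P) n))))))
    (subst (λ a → CS a (first K f n + sh κ (first K P) n) ((first K f n + off K f n) + sh κ (λ m → first K P m + off K P m) n)) (sym (rec n))
      (CS-add (moments K n) h))

  -- Here copies of κ may occur but are not counted in X, so removing them one by one leaves the
  -- moments untranslated.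
  below : ∀ n → Moments K P n
  below n = go n n ≤-refl
    where
    go : ∀ b n → n ≤ b → Moments K P n
    go b zero _ = step zero (cs z≤n)
    go (suc b) (suc n) (s≤s n≤b) = step (suc n) (CS-sh K n λ m m≤n → go b m (≤-trans m≤n n≤b))

  regroup-b : ∀ a b c → (a + b) + c ≡ a + (b + c)
  regroup-b = solve-∀
  eq-b : first κ P n ≡ first K f n + sh κ b₁ n
  eq-b = trans (cong (_+ sh κ P n) (first-rec κ rec K n))
    (trans (regroup-b (first K f n) _ _) (cong (first K f n +_) (sym (sh-add κ (first K P) P n))))
  regroup-c : ∀ m m′ q o o′ → ((m + m′) + q) + ((o + o′) + 2 * m′) ≡ (m + o) + (((m′ + o′) + 2 * m′) + q)
  regroup-c = solve-∀
  eq-c : first κ P n + off κ P n ≡ (first K f n + off K f n) + sh κ c₁ n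
  eq-c = trans (cong₂ (λ x y → (x + sh κ P n) + (y + 2 * sh κ (first K P) n)) (first-rec κ rec K n) (off-rec κ rec K n))
    (trans (regroup-c (first K f n) (sh κ (first K P) n) (sh κ P n) (off K f n) (sh κ (off K P) n))
      (cong ((first K f n + off K f n) +_) (sym
        (trans (sh-add κ (λ m → (first K P m + off K P m) + 2 * first K P m) P n)
          (cong (_+ sh κ P n) (trans (sh-add κ (λ m → first K P m + off K P m) _ n)
            (cong₂ _+_ (sh-add κ (first K P) (off K P) n) (sh-*ˡ κ 2 (first K P) n))))))))

-- M n = Σ_{k≥1} p(n-k)  and  Z n = Σ_{k≥1} k p(n-k)

M Z : ℕ → ℕ
M = pre p
Z n = pre M (suc n)

diagonal : ℕ → (ℕ → ℕ) → ℕ → ℕ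
diagonal K f n = ∑ K (λ k → sh (suc k + suc k) f n)

-- The double sum of f(n-k-l) over all k and l, split into k ≠ l and k = l. For `p` the double sum
-- is Z - M, which is how Z enters the second moment.
off+diagonal : ∀ K f n → ∑ K (λ k → sh (suc k) (first K f) n) ≡ off K f n + diagonal K f n
off+diagonal zero f n = refl
off+diagonal (suc K) f n = begin
  ∑ K (λ k → sh (suc k) (first κ f) n) + sh κ (first κ f) n
    ≡⟨ cong₂ _+_ (trans (∑-cong K λ k → sh-add (suc k) (first K f) (sh κ f) n) (∑-+ K _ _)) (sh-add κ (first K f) (sh κ f) n) ⟩
  (∑ K (λ k → sh (suc k) (first K f) n) + ∑ K (λ k → sh (suc k) (sh κ f) n)) + (sh κ (first K f) n + sh κ (sh κ f) n)
    ≡⟨ cong₂ (λ x y → (x + y) + (sh κ (first K f) n + sh κ (sh κ f) n)) (off+diagonal K f n)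
         (trans (∑-cong K λ k → sh-comm (suc k) κ f n) (sym (sh-∑ κ K (λ k → sh (suc k) f) n))) ⟩
  ((o + d) + c) + (c + sh κ (sh κ f) n)
    ≡⟨ cong (λ x → ((o + d) + c) + (c + x)) (sh-sh κ κ f n) ⟩
  ((o + d) + c) + (c + e)
    ≡⟨ regroup o d c e ⟩
  (o + 2 * c) + (d + e) ∎
  where
  open ≡-Reasoning
  κ = suc K
  o = off K f n
  d = diagonal K f n
  c = sh κ (first K f) n
  e = sh (κ + κ) f n
  regroup : ∀ o d c e → ((o + d) + c) + (c + e) ≡ (o + 2 * c) + (d + e)
  regroup = solve-∀

diagonal-cong : ∀ K {f g} n → (∀ m → m ≤ n → f m ≡ g m) → diagonal K f n ≡ diagonal K g n
diagonal-cong K n e = ∑-cong K λ k → sh-cong (suc k + suc k) n e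

diagonal-step : ∀ K f n → diagonal (suc K) f (suc (suc n)) ≡ f n + diagonal K f n
diagonal-step K f n = trans
  (∑-cong (suc K) λ k → cong (λ i → sh i f (suc n)) (+-suc k k))
  (∑-front K (λ k → sh (k + k) f n))

-- Monotonicity bounds each odd shift p(n-2k-1) by p(n-2k); the shift by 1 is paid by p(n).
M≤2diagonal+p : ∀ n {K} → n ≤ K → M n ≤ 2 * diagonal K p n + p n
M≤2diagonal+p zero _ = z≤n
M≤2diagonal+p (suc zero) _ = ≤-trans (p-mono-suc 0) (m≤n+m (p 1) _)
M≤2diagonal+p (suc (suc n)) {suc K} (s≤s n<K) = begin
  M n + p n + p (suc n)
    ≤⟨ +-mono-≤ (+-monoˡ-≤ (p n) (M≤2diagonal+p n {K} (<⇒≤ n<K))) (p-mono-suc (suc n)) ⟩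
  (2 * d + p n) + p n + p (suc (suc n))
    ≡⟨ regroup d (p n) (p (suc (suc n))) ⟩
  2 * (p n + d) + p (suc (suc n))
    ≡⟨ cong (λ x → 2 * x + p (suc (suc n))) (sym (diagonal-step K p n)) ⟩
  2 * diagonal (suc K) p (suc (suc n)) + p (suc (suc n)) ∎
  where
  open ≤-Reasoning
  d = diagonal K p n
  regroup : ∀ d x y → (2 * d + x) + x + y ≡ 2 * (x + d) + y
  regroup = solve-∀

-- Cauchy–Schwarz for the number of distinct part sizes on the partitions of n.
M²+p*diagonal≤pZ : ∀ n → M n * M n + p n * diagonal n p n ≤ p n * Z n
M²+p*diagonal≤pZ n = begin
  M n * M n + p n * d        ≤⟨ +-monoˡ-≤ (p n * d) (subst₂ (λ x y → x * x ≤ p n * (y + o)) first-M first-M (CS.b²≤ac (moments n n))) ⟩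
  p n * (M n + o) + p n * d  ≡⟨ collect (p n) (M n) o d ⟩
  p n * ((o + d) + M n)      ≡⟨ cong (λ x → p n * (x + M n)) (sym sum-off) ⟩
  p n * Z n                  ∎
  where
  open ≤-Reasoning
  f = partsAtMost n
  o = off n f n
  d = diagonal n p n
  stable : ∀ m → m ≤ n → f m ≡ p m
  stable m = partsAtMost-p
  pre-cong : ∀ m → m ≤ n → pre f m ≡ M m
  pre-cong m m≤n = ∑-cong< m λ k k<m → stable k (≤-trans (<⇒≤ k<m) m≤n)
  first-M : first n f n ≡ M n
  first-M = trans (∑-sh-suc f n ≤-refl) (pre-cong n ≤-refl)
  sum-off : pre M n ≡ o + d
  sum-off = trans (sym (∑-sh-suc M n ≤-refl))
    (trans (∑-cong n λ k → sh-cong (suc k) n λ m m≤n → sym (trans (∑-sh-suc f m m≤n) (pre-cong m m≤n)))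
      (trans (off+diagonal n f n) (cong (o +_) (diagonal-cong n n stable))))
  collect : ∀ q m o d → q * (m + o) + q * d ≡ q * ((o + d) + m)
  collect = solve-∀

M²≤pZ : ∀ n → M n * M n ≤ p n * Z n
M²≤pZ n = ≤-trans (m≤m+n _ _) (M²+p*diagonal≤pZ n)

-- Eliminates Σ p(n-2k), so that only M, Z and p remain for the estimate of (Z-M)(Z+M+p).
2M²+pM≤2pZ+p² : ∀ n → 2 * (M n * M n) + p n * M n ≤ 2 * (p n * Z n) + p n * p n
2M²+pM≤2pZ+p² n = begin
  2 * (M n * M n) + p n * M n            ≤⟨ +-monoʳ-≤ (2 * (M n * M n)) (*-monoʳ-≤ (p n) (M≤2diagonal+p n ≤-refl)) ⟩
  2 * (M n * M n) + p n * (2 * d + p n)  ≡⟨ regroup (M n * M n) (p n) d ⟩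
  2 * (M n * M n + p n * d) + p n * p n  ≤⟨ +-monoˡ-≤ (p n * p n) (*-monoʳ-≤ 2 (M²+p*diagonal≤pZ n)) ⟩
  2 * (p n * Z n) + p n * p n            ∎
  where
  open ≤-Reasoning
  d = diagonal n p n
  regroup : ∀ m q d → 2 * m + q * (2 * d + q) ≡ 2 * (m + q * d) + q * q
  regroup = solve-∀

-- The divisor sum

χ₀ : ℕ → ℕ
χ₀ zero = 1
χ₀ (suc _) = 0

σ : ℕ → ℕ
σ k = ∑ k (λ i → suc i * χ₀ (k % suc i))

δ : ℕ → ℕ → ℕ
δ x y = if x ≡ᵇ y then 1 else 0

δ-refl : ∀ x → δ x x ≡ 1
δ-refl zero = refl
δ-refl (suc x) = δ-refl x

δ-≢ : ∀ {x y} → x ≢ y → δ x y ≡ 0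
δ-≢ {zero} {zero} ne = contradiction refl ne
δ-≢ {zero} {suc y} ne = refl
δ-≢ {suc x} {zero} ne = refl
δ-≢ {suc x} {suc y} ne = δ-≢ {x} {y} (ne ∘ cong suc)

∑-δ-≥ : ∀ B (F : ℕ → ℕ) {x} → B ≤ x → ∑ B (λ k → δ x k * F k) ≡ 0
∑-δ-≥ B F {x} B≤x = ∑-0 B λ k k<B → cong (_* F k) (δ-≢ {x} {k} (>⇒≢ (≤-trans k<B B≤x)))

∑-δ-< : ∀ B (F : ℕ → ℕ) {x} → x < B → ∑ B (λ k → δ x k * F k) ≡ F x
∑-δ-< (suc B) F {x} x<B with x ≟ B
... | yes refl = trans (cong₂ _+_ (∑-δ-≥ x F ≤-refl) (cong (_* F x) (δ-refl x))) (+-identityʳ (F x))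
... | no x≢B = trans (cong₂ _+_ (∑-δ-< B F (≤∧≢⇒< (s≤s⁻¹ x<B) x≢B)) (cong (_* F B) (δ-≢ x≢B))) (+-identityʳ (F x))

-- The cofactor of a divisor is unique. Positivity of k excludes 0, which every number divides but
-- which is no product of positive factors.
χ₀-count : ∀ B k i → 0 < k → k ≤ B → χ₀ (k % suc i) ≡ ∑ B (λ j → δ (suc j * suc i) k)
χ₀-count B k i 0<k k≤B with k % suc i in eq | m≡m%n+[m/n]*n k (suc i)
... | suc r | _ = sym (∑-0 B λ j _ → δ-≢ {suc j * suc i} {k} λ e → 1+n≢0 (trans (sym eq) (trans (cong (_% suc i) (sym e)) (m*n%n≡0 (suc j) (suc i)))))
... | zero | e with k / suc i
...   | zero = contradiction (sym e) (<⇒≢ 0<k)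
...   | suc j₀ = sym (trans (∑-cong B λ j → trans (δ-mult j) (sym (*-identityʳ (δ j₀ j)))) (∑-δ-< B (λ _ → 1) j₀<B))
  where
  j₀<B : j₀ < B
  j₀<B = ≤-trans (m≤m*n (suc j₀) (suc i)) (subst (_≤ B) e k≤B)
  δ-mult : ∀ j → δ (suc j * suc i) k ≡ δ j₀ j
  δ-mult j with j₀ ≟ j
  ... | yes refl = trans (cong (δ (suc j * suc i)) e) (trans (δ-refl (suc j * suc i)) (sym (δ-refl j₀)))
  ... | no j₀≢j = trans (δ-≢ λ e′ → j₀≢j (suc-injective (sym (*-cancelʳ-≡ (suc j) (suc j₀) (suc i) (trans e′ e))))) (sym (δ-≢ j₀≢j))

σ-δ : ∀ B k → k ≤ B → σ k ≡ ∑ B (λ i → ∑ B (λ j → suc i * δ (suc j * suc i) k))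
σ-δ B zero _ = sym (∑-0 B λ i _ → ∑-0 B λ j _ → *-zeroʳ (suc i))
σ-δ B k@(suc k′) k≤B = trans (sym (∑-extend k≤B λ i k≤i → trans (cong (λ r → suc i * χ₀ r) (m<n⇒m%n≡m (s≤s k≤i))) (*-zeroʳ (suc i))))
  (∑-cong B λ i → trans (cong (suc i *_) (χ₀-count B k i z<s k≤B)) (sym (∑-*ˡ B (suc i) _)))

-- A sum weighted by σ is a sum over factorisations. With F(k) = p(n-k) it gives the recurrence for
-- p, with F = 1 the average order of σ.
∑σ : ∀ B (F : ℕ → ℕ) → ∑ B (λ k → σ k * F k) ≡ ∑ B (λ i → ∑ B (λ j → suc i * ∑ B (λ k → δ (suc j * suc i) k * F k)))
∑σ B F = begin
  ∑ B (λ k → σ k * F k)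
    ≡⟨ ∑-cong< B (λ k k<B → trans (cong (_* F k) (σ-δ B k (<⇒≤ k<B)))
         (trans (sym (∑-*ʳ B _ (F k))) (∑-cong B λ i → trans (sym (∑-*ʳ B _ (F k))) (∑-cong B λ j → *-assoc (suc i) (δ (suc j * suc i) k) (F k))))) ⟩
  ∑ B (λ k → ∑ B (λ i → ∑ B (λ j → suc i * (δ (suc j * suc i) k * F k))))
    ≡⟨ ∑-swap B B _ ⟩
  ∑ B (λ i → ∑ B (λ k → ∑ B (λ j → suc i * (δ (suc j * suc i) k * F k))))
    ≡⟨ ∑-cong B (λ i → trans (∑-swap B B _) (∑-cong B λ j → ∑-*ˡ B (suc i) _)) ⟩
  ∑ B (λ i → ∑ B (λ j → suc i * ∑ B (λ k → δ (suc j * suc i) k * F k))) ∎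
  where open ≡-Reasoning

n*p≡σ⋆p : ∀ n → n * p n ≡ (σ ⋆ p) n
n*p≡σ⋆p n = trans (n*p n (n≤1+n n)) (sym (trans (∑σ (suc n) (λ k → sh k p n))
  (∑-cong (suc n) λ i → ∑-cong (suc n) λ j → cong (suc i *_) (pick (suc j * suc i)))))
  where
  pick : ∀ x → ∑ (suc n) (λ k → δ x k * sh k p n) ≡ sh x p n
  pick x with x <? suc n
  ... | yes x≤n = ∑-δ-< (suc n) (λ k → sh k p n) x≤n
  ... | no  x≰n = trans (∑-δ-≥ (suc n) (λ k → sh k p n) (≮⇒≥ x≰n)) (sym (sh-< p (≮⇒≥ x≰n)))

-- Partial sums of σ:  Σ_{k≤X} σ(k) ≤ (7/4) X(X+1)/2

triangle : ℕ → ℕ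
triangle q = ∑ q suc

2*triangle : ∀ q → 2 * triangle q ≡ q * suc q
2*triangle zero = refl
2*triangle (suc q) = trans (*-distribˡ-+ 2 (triangle q) (suc q)) (trans (cong (_+ 2 * suc q) (2*triangle q)) (collect q))
  where
  collect : ∀ q → q * suc q + 2 * suc q ≡ suc q * suc (suc q)
  collect = solve-∀

∑-id : ∀ X → ∑ (suc X) id ≡ triangle X
∑-id X = ∑-front X id

∑-truncate : ∀ B q {f g} → (∀ i → f i ≤ g i) → (∀ i → q ≤ i → f i ≡ 0) → ∑ B f ≤ ∑ q g
∑-truncate B q {f} f≤g zero-beyond with ≤-total B q
... | inj₁ B≤q = ≤-trans (∑-monoˡ B≤q f) (∑-mono q f≤g)
... | inj₂ q≤B = ≤-trans (≤-reflexive (∑-extend q≤B zero-beyond)) (∑-mono q f≤g)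

-- Factorisations are grouped by the cofactor j+1, which leaves the divisors up to X/(j+1).
∑σ≤ : ∀ X → ∑ (suc X) σ ≤ ∑ (suc X) (λ j → triangle (X / suc j))
∑σ≤ X = begin
  ∑ B σ                        ≡⟨ ∑-cong B (λ k → sym (*-identityʳ (σ k))) ⟩
  ∑ B (λ k → σ k * 1)          ≡⟨ ∑σ B (λ _ → 1) ⟩
  ∑ B (λ i → ∑ B (λ j → suc i * hits (suc j * suc i)))  ≡⟨ ∑-swap B B _ ⟩
  ∑ B (λ j → ∑ B (λ i → suc i * hits (suc j * suc i)))
    ≤⟨ ∑-mono B (λ j → ∑-truncate B (X / suc j) (λ i → ≤-trans (*-monoʳ-≤ (suc i) (hits≤1 (suc j * suc i))) (≤-reflexive (*-identityʳ (suc i))))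
         (λ i q≤i → trans (cong (suc i *_) (hits-0 (beyond j i q≤i))) (*-zeroʳ (suc i)))) ⟩
  ∑ B (λ j → triangle (X / suc j)) ∎
  where
  open ≤-Reasoning
  B = suc X
  hits : ℕ → ℕ
  hits x = ∑ B (λ k → δ x k * 1)
  hits-0 : ∀ {x} → B ≤ x → hits x ≡ 0
  hits-0 = ∑-δ-≥ B (λ _ → 1)
  hits≤1 : ∀ x → hits x ≤ 1
  hits≤1 x with x <? B
  ... | yes x<B = ≤-reflexive (∑-δ-< B (λ _ → 1) x<B)
  ... | no  x≮B = ≤-trans (≤-reflexive (hits-0 (≮⇒≥ x≮B))) z≤n
  beyond : ∀ j i → X / suc j ≤ i → B ≤ suc j * suc i
  beyond j i q≤i = subst (B ≤_) (*-comm (suc i) (suc j)) (≤-trans (m<[1+m/n]*n X (suc j)) (*-monoˡ-≤ (suc j) (s≤s q≤i)))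
    where
    m<[1+m/n]*n : ∀ m d .{{_ : NonZero d}} → m < suc (m / d) * d
    m<[1+m/n]*n m d = subst (_< suc (m / d) * d) (sym (m≡m%n+[m/n]*n m d)) (+-monoˡ-< (m / d * d) (m%n<n m d))

∑-split : ∀ a b f → ∑ (a + b) f ≡ ∑ a f + ∑ b (λ i → f (a + i))
∑-split a zero f = trans (cong (λ x → ∑ x f) (+-identityʳ a)) (sym (+-identityʳ _))
∑-split a (suc b) f = trans (cong (λ x → ∑ x f) (+-suc a b)) (trans (cong (_+ f (a + b)) (∑-split a b f)) (+-assoc (∑ a f) _ _))

-- Loses a factor of nearly 2 for large q. It is spent only on cofactors above 12, where it turns
-- the tail 1/12 of Σ 1/d² into 1/6.
triangle≤sq : ∀ q → triangle q ≤ q * q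
triangle≤sq zero = z≤n
triangle≤sq (suc q) = ≤-trans (+-monoˡ-≤ (suc q) (triangle≤sq q)) (subst (q * q + suc q ≤_) (sym (expand q)) (m≤m+n _ q))
  where
  expand : ∀ q → suc q * suc q ≡ (q * q + suc q) + q
  expand = solve-∀

-- Telescoping  Σ_{d>12} 1/d² ≤ 1/12.
triangle-tail : ∀ X t → 12 * (12 + t) * ∑ t (λ i → triangle (X / suc (12 + i))) ≤ X * X * t
triangle-tail X zero = ≤-reflexive (sym (*-zeroʳ (X * X)))
triangle-tail X (suc t) = subst (λ y → 12 * y * (S + h) ≤ X * X * suc t) (sym (+-suc 12 t)) (*-cancelˡ-≤ (m * suc m) main)
  where
  open ≤-Reasoning
  m = 12 + t
  S = ∑ t (λ i → triangle (X / suc (12 + i)))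
  q = X / suc m
  h = triangle q
  qm≤X : q * suc m ≤ X
  qm≤X = m/n*n≤m X (suc m)
  expand : ∀ m S h → m * suc m * (12 * suc m * (S + h)) ≡ suc m * suc m * (12 * m * S) + 12 * m * (suc m * suc m * h)
  expand = solve-∀
  collect : ∀ q m → suc m * suc m * (q * q) ≡ (q * suc m) * (q * suc m)
  collect = solve-∀
  last : ∀ t Y → (12 + t) * suc (12 + t) * (Y * suc t) ≡ suc (12 + t) * suc (12 + t) * (Y * t) + 12 * (12 + t) * Y + 12 * Y
  last = solve-∀
  main : m * suc m * (12 * suc m * (S + h)) ≤ m * suc m * (X * X * suc t)
  main = begin
    m * suc m * (12 * suc m * (S + h))
      ≡⟨ expand m S h ⟩
    suc m * suc m * (12 * m * S) + 12 * m * (suc m * suc m * h)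
      ≤⟨ +-mono-≤ (*-monoʳ-≤ (suc m * suc m) (triangle-tail X t))
           (*-monoʳ-≤ (12 * m) (≤-trans (*-monoʳ-≤ (suc m * suc m) (triangle≤sq q)) (≤-trans (≤-reflexive (collect q m)) (*-mono-≤ qm≤X qm≤X)))) ⟩
    suc m * suc m * (X * X * t) + 12 * m * (X * X)
      ≤⟨ m≤m+n _ (12 * (X * X)) ⟩
    suc m * suc m * (X * X * t) + 12 * m * (X * X) + 12 * (X * X)
      ≡⟨ sym (last t (X * X)) ⟩
    m * suc m * (X * X * suc t) ∎

-- In the application c is a common multiple of the squares d² with d ≤ 12, and w i = c / (i+1)².
triangle-head : ∀ c (w : ℕ → ℕ) → (∀ {i} → i < 12 → w i * (suc i * suc i) ≡ c) → ∀ X →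
  2 * c * ∑ 12 (λ i → triangle (X / suc i)) ≤ ∑ 12 w * (X * X) + ∑ 12 (λ i → w i * suc i) * X
triangle-head c w w-spec X = begin
  2 * c * ∑ 12 h  ≡⟨ sym (∑-*ˡ 12 (2 * c) h) ⟩
  ∑ 12 (λ i → 2 * c * h i)  ≤⟨ ∑-mono< 12 each ⟩
  ∑ 12 (λ i → w i * (X * X) + w i * suc i * X)  ≡⟨ ∑-+ 12 (λ i → w i * (X * X)) (λ i → w i * suc i * X) ⟩
  ∑ 12 (λ i → w i * (X * X)) + ∑ 12 (λ i → w i * suc i * X)
    ≡⟨ cong₂ _+_ (∑-*ʳ 12 w (X * X)) (∑-*ʳ 12 (λ i → w i * suc i) X) ⟩
  ∑ 12 w * (X * X) + ∑ 12 (λ i → w i * suc i) * X ∎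
  where
  open ≤-Reasoning
  h : ℕ → ℕ
  h i = triangle (X / suc i)
  regroup : ∀ c d t → 2 * (c * (d * d)) * t ≡ c * (d * d) * (2 * t)
  regroup = solve-∀
  regroup′ : ∀ c d q → c * (d * d) * (q * suc q) ≡ c * ((q * d) * (q * d + d))
  regroup′ = solve-∀
  distribute : ∀ c d X → c * (X * (X + d)) ≡ c * (X * X) + c * d * X
  distribute = solve-∀
  each : ∀ i → i < 12 → 2 * c * h i ≤ w i * (X * X) + w i * suc i * X
  each i i<12 = begin
    2 * c * h i               ≡⟨ cong (λ x → 2 * x * h i) (sym (w-spec i<12)) ⟩
    2 * (w i * (suc i * suc i)) * h i   ≡⟨ regroup (w i) (suc i) (h i) ⟩
    w i * (suc i * suc i) * (2 * h i)   ≡⟨ cong (w i * (suc i * suc i) *_) (2*triangle q) ⟩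
    w i * (suc i * suc i) * (q * suc q) ≡⟨ regroup′ (w i) (suc i) q ⟩
    w i * ((q * suc i) * (q * suc i + suc i)) ≤⟨ *-monoʳ-≤ (w i) (*-mono-≤ qd≤X (+-monoˡ-≤ (suc i) qd≤X)) ⟩
    w i * (X * (X + suc i))             ≡⟨ distribute (w i) (suc i) X ⟩
    w i * (X * X) + w i * suc i * X       ∎
    where
    q = X / suc i
    qd≤X : q * suc i ≤ X
    qd≤X = m/n*n≤m X (suc i)

-- The general estimate absorbs its linear error term only from X = 80 on.
∑σ-small : ∀ {K} → K < 81 → 4 * ∑ K σ ≤ 7 * ∑ K id
∑σ-small = toWitness {a? = allUpTo? (λ K → 4 * ∑ K σ ≤? 7 * ∑ K id) 81} tt

-- In the application D and E are the slacks 21c - 2c - 12C₁ and 12C₂ - 21c; the former is positive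
-- because Σ_{d≤12} 1/d² + 1/6 < 7/4.
∑σ-large : ∀ c .{{_ : NonZero c}} (w : ℕ → ℕ) → (∀ {i} → i < 12 → w i * (suc i * suc i) ≡ c) →
  ∀ D E → 12 * ∑ 12 w + 2 * c + D ≡ 21 * c → 12 * ∑ 12 (λ i → w i * suc i) ≡ 21 * c + E → E ≤ D * 80 →
  ∀ X → 80 ≤ X → 4 * ∑ (suc X) σ ≤ 7 * ∑ (suc X) id
∑σ-large c w w-spec D E e₁ e₂ E≤80D X 80≤X = *-cancelˡ-≤ (6 * c) {{m*n≢0 6 c}} (begin
  6 * c * (4 * ∑ (suc X) σ)             ≤⟨ *-monoʳ-≤ (6 * c) (*-monoʳ-≤ 4 S≤H+R) ⟩
  6 * c * (4 * (H + R))                 ≡⟨ regroup c H R ⟩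
  12 * (2 * c * H) + 2 * c * (12 * R)   ≤⟨ +-mono-≤ (*-monoʳ-≤ 12 (triangle-head c w w-spec X)) (*-monoʳ-≤ (2 * c) 12R≤X²) ⟩
  12 * (C₁ * (X * X) + C₂ * X) + 2 * c * (X * X)
                                        ≡⟨ eq₁ c C₁ C₂ X ⟩
  (12 * C₁ + 2 * c) * (X * X) + 12 * C₂ * X          ≡⟨ cong (λ y → (12 * C₁ + 2 * c) * (X * X) + y * X) e₂ ⟩
  (12 * C₁ + 2 * c) * (X * X) + (21 * c + E) * X     ≤⟨ +-monoʳ-≤ ((12 * C₁ + 2 * c) * (X * X)) (*-monoˡ-≤ X (+-monoʳ-≤ (21 * c) (≤-trans E≤80D (*-monoʳ-≤ D 80≤X)))) ⟩
  (12 * C₁ + 2 * c) * (X * X) + (21 * c + D * X) * X ≡⟨ eq₂ (12 * C₁ + 2 * c) (21 * c) D X ⟩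
  (12 * C₁ + 2 * c + D) * (X * X) + 21 * c * X       ≡⟨ cong (λ y → y * (X * X) + 21 * c * X) e₁ ⟩
  21 * c * (X * X) + 21 * c * X         ≡⟨ eq₃ (21 * c) X ⟩
  21 * c * (X * suc X)                  ≡⟨ cong (21 * c *_) (sym (2*triangle X)) ⟩
  21 * c * (2 * triangle X)             ≡⟨ regroup′ c (triangle X) ⟩
  6 * c * (7 * triangle X)              ≡⟨ cong (λ t → 6 * c * (7 * t)) (sym (∑-id X)) ⟩
  6 * c * (7 * ∑ (suc X) id)            ∎)
  where
  open ≤-Reasoning
  t H R C₁ C₂ : ℕ
  C₁ = ∑ 12 w
  C₂ = ∑ 12 (λ i → w i * suc i)
  t = suc X ∸ 12
  12+t≡1+X : 12 + t ≡ suc X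
  12+t≡1+X = m+[n∸m]≡n (≤-trans (≤ᵇ⇒≤ 12 80 tt) (m≤n⇒m≤1+n 80≤X))
  H = ∑ 12 (λ j → triangle (X / suc j))
  R = ∑ t (λ i → triangle (X / suc (12 + i)))
  S≤H+R : ∑ (suc X) σ ≤ H + R
  S≤H+R = ≤-trans (∑σ≤ X) (≤-reflexive (trans (cong (λ B → ∑ B (λ j → triangle (X / suc j))) (sym 12+t≡1+X)) (∑-split 12 t (λ j → triangle (X / suc j)))))
  12R≤X² : 12 * R ≤ X * X
  12R≤X² = *-cancelˡ-≤ (12 + t) (≤-trans (≤-reflexive (swap (12 + t) R)) (≤-trans (triangle-tail X t)
    (≤-trans (*-monoʳ-≤ (X * X) (m≤n+m t 12)) (≤-reflexive (*-comm (X * X) (12 + t))))))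
    where
    swap : ∀ m R → m * (12 * R) ≡ 12 * m * R
    swap = solve-∀
  regroup : ∀ c H R → 6 * c * (4 * (H + R)) ≡ 12 * (2 * c * H) + 2 * c * (12 * R)
  regroup = solve-∀
  regroup′ : ∀ c t → 21 * c * (2 * t) ≡ 6 * c * (7 * t)
  regroup′ = solve-∀
  eq₁ : ∀ c C₁ C₂ X → 12 * (C₁ * (X * X) + C₂ * X) + 2 * c * (X * X) ≡ (12 * C₁ + 2 * c) * (X * X) + 12 * C₂ * X
  eq₁ = solve-∀
  eq₂ : ∀ a b D X → a * (X * X) + (b + D * X) * X ≡ (a + D) * (X * X) + b * X
  eq₂ = solve-∀
  eq₃ : ∀ b X → b * (X * X) + b * X ≡ b * (X * suc X)
  eq₃ = solve-∀

4∑σ≤7∑id : ∀ K → 4 * ∑ K σ ≤ 7 * ∑ K id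
4∑σ≤7∑id K with K <? 81
... | yes K<81 = ∑σ-small K<81
4∑σ≤7∑id zero | no _ = z≤n
4∑σ≤7∑id (suc X) | no X≮80 =
  -- 27720 is the least common multiple of 1, ..., 12. The two large numerals are the slacks D and
  -- E, whose quotient E/D is below 74.
  ∑σ-large (27720 * 27720) w w-spec 169263060 12477659040 refl refl (≤ᵇ⇒≤ 12477659040 (169263060 * 80) tt)
    X (s≤s⁻¹ (≮⇒≥ X≮80))
  where
  w : ℕ → ℕ
  w i = (27720 / suc i) * (27720 / suc i)
  w-spec : ∀ {i} → i < 12 → w i * (suc i * suc i) ≡ 27720 * 27720
  w-spec = toWitness {a? = allUpTo? (λ i → w i * (suc i * suc i) ≟ 27720 * 27720) 12} tt

τ : ℕ → ℕ
τ k = σ k ∸ k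

σ≡k+τ : ∀ k → σ k ≡ k + τ k
σ≡k+τ k = sym (m+[n∸m]≡n (k≤σ k))
  where
  k≤σ : ∀ k → k ≤ σ k
  k≤σ zero = z≤n
  k≤σ (suc k) = ≤-trans (≤-reflexive (trans (sym (*-identityʳ (suc k))) (cong (λ r → suc k * χ₀ r) (sym (n%n≡0 (suc k))))))
    (m≤n+m _ (∑ k (λ i → suc i * χ₀ (suc k % suc i))))

4∑τ≤3∑id : ∀ K → 4 * ∑ K τ ≤ 3 * ∑ K id
4∑τ≤3∑id K = +-cancelˡ-≤ (4 * ∑ K id) _ _ (begin
  4 * ∑ K id + 4 * ∑ K τ  ≡⟨ sym (*-distribˡ-+ 4 (∑ K id) _) ⟩
  4 * (∑ K id + ∑ K τ)    ≡⟨ cong (4 *_) (sym (trans (∑-cong K σ≡k+τ) (∑-+ K id τ))) ⟩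
  4 * ∑ K σ               ≤⟨ 4∑σ≤7∑id K ⟩
  7 * ∑ K id              ≡⟨ *-distribʳ-+ (∑ K id) 4 3 ⟩
  4 * ∑ K id + 3 * ∑ K id ∎)
  where open ≤-Reasoning

n*p≡Z+τ⋆p : ∀ n → n * p n ≡ Z n + (τ ⋆ p) n
n*p≡Z+τ⋆p n = trans (n*p≡σ⋆p n) (trans (⋆-congˡ p n σ≡k+τ) (trans (⋆-+ˡ id τ p n) (cong (_+ (τ ⋆ p) n) (k⋆ p n))))

Z≤n*p : ∀ n → Z n ≤ n * p n
Z≤n*p n = subst (Z n ≤_) (sym (n*p≡Z+τ⋆p n)) (m≤m+n _ _)

4np≤7Z : ∀ n → 4 * (n * p n) ≤ 7 * Z n
4np≤7Z n = begin
  4 * (n * p n)              ≡⟨ cong (4 *_) (n*p≡σ⋆p n) ⟩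
  4 * (σ ⋆ p) n              ≡⟨ sym (⋆-*ˡ 4 σ p n) ⟩
  ((λ k → 4 * σ k) ⋆ p) n    ≤⟨ ⋆-abel _ _ p-mono-suc (λ K → subst₂ _≤_ (sym (∑-*ˡ K 4 σ)) (sym (∑-*ˡ K 7 id)) (4∑σ≤7∑id K)) n ⟩
  ((λ k → 7 * k) ⋆ p) n      ≡⟨ ⋆-*ˡ 7 id p n ⟩
  7 * (id ⋆ p) n             ≡⟨ cong (7 *_) (k⋆ p n) ⟩
  7 * Z n                    ∎
  where open ≤-Reasoning

-- Applying Z(m) ≤ m p(m) ≤ n p(m) inside Σ k Z(n-k) gives order n Z, a factor n better than the
-- trivial k² ≤ n². This makes the quadratic correction to f(n-k) a lower-order term.
k³⋆p≤ : ∀ n → ((λ k → k * k * k) ⋆ p) n ≤ (6 * n + 1) * Z n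
k³⋆p≤ n = begin
  ((λ k → k * k * k) ⋆ p) n           ≡⟨ k³⋆ p n ⟩
  6 * pre (pre Z) (suc n) + Z n       ≤⟨ +-monoˡ-≤ (Z n) (*-monoʳ-≤ 6 double) ⟩
  6 * (n * Z n) + Z n                 ≡⟨ collect n (Z n) ⟩
  (6 * n + 1) * Z n                   ∎
  where
  open ≤-Reasoning
  collect : ∀ n z → 6 * (n * z) + z ≡ (6 * n + 1) * z
  collect = solve-∀
  swap : ∀ k n x → k * (n * x) ≡ n * (k * x)
  swap = solve-∀
  double : pre (pre Z) (suc n) ≤ n * Z n
  double = begin
    pre (pre Z) (suc n)              ≡⟨ sym (k⋆ Z n) ⟩
    (id ⋆ Z) n                       ≤⟨ ∑-mono (suc n) (λ k → *-monoʳ-≤ k (sh-≤ k n λ m m≤n → ≤-trans (Z≤n*p m) (*-monoˡ-≤ (p m) m≤n))) ⟩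
    (id ⋆ (λ m → n * p m)) n         ≡⟨ ∑-cong (suc n) (λ k → trans (cong (k *_) (sh-*ˡ k n p n)) (swap k n (sh k p n))) ⟩
    ∑ (suc n) (λ k → n * (k * sh k p n)) ≡⟨ ∑-*ˡ (suc n) n _ ⟩
    n * (id ⋆ p) n                   ≡⟨ cong (n *_) (k⋆ p n) ⟩
    n * Z n                          ∎

∑-cubes : ∀ X → ∑ (suc X) (λ k → k * k * k) ≡ triangle X * triangle X
∑-cubes zero = refl
∑-cubes (suc X) = begin
  ∑ (suc X) (λ k → k * k * k) + suc X * suc X * suc X  ≡⟨ cong₂ _+_ (∑-cubes X) (split X) ⟩
  t * t + ((X * suc X) * suc X + suc X * suc X)        ≡⟨ cong (λ y → t * t + (y * suc X + suc X * suc X)) (sym (2*triangle X)) ⟩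
  t * t + (2 * t * suc X + suc X * suc X)              ≡⟨ square t (suc X) ⟩
  (t + suc X) * (t + suc X) ∎
  where
  open ≡-Reasoning
  t = triangle X
  split : ∀ X → suc X * suc X * suc X ≡ (X * suc X) * suc X + suc X * suc X
  split = solve-∀
  square : ∀ t y → t * t + (2 * t * y + y * y) ≡ (t + y) * (t + y)
  square = solve-∀

-- By Abel summation only partial sums matter; there k² is replaced by X², and X² ≤ 2 T for the
-- triangular number T, whose square is the sum of cubes.
τk²⋆p≤ : ∀ n → 4 * ((λ k → τ k * (k * k)) ⋆ p) n ≤ 6 * ((6 * n + 1) * Z n)
τk²⋆p≤ n = begin
  4 * ((λ k → τ k * (k * k)) ⋆ p) n      ≡⟨ sym (⋆-*ˡ 4 (λ k → τ k * (k * k)) p n) ⟩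
  ((λ k → 4 * (τ k * (k * k))) ⋆ p) n    ≤⟨ ⋆-abel _ _ p-mono-suc partial n ⟩
  ((λ k → 6 * (k * k * k)) ⋆ p) n        ≡⟨ ⋆-*ˡ 6 (λ k → k * k * k) p n ⟩
  6 * ((λ k → k * k * k) ⋆ p) n          ≤⟨ *-monoʳ-≤ 6 (k³⋆p≤ n) ⟩
  6 * ((6 * n + 1) * Z n)                ∎
  where
  open ≤-Reasoning
  regroup : ∀ X t → 3 * t * (X * X) + 3 * t * X ≡ 3 * t * (X * suc X)
  regroup = solve-∀
  regroup′ : ∀ t → 3 * t * (2 * t) ≡ 6 * (t * t)
  regroup′ = solve-∀
  partial : ∀ K → ∑ K (λ k → 4 * (τ k * (k * k))) ≤ ∑ K (λ k → 6 * (k * k * k))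
  partial zero = z≤n
  partial (suc X) = begin
    ∑ (suc X) (λ k → 4 * (τ k * (k * k)))  ≡⟨ ∑-*ˡ (suc X) 4 _ ⟩
    4 * ∑ (suc X) (λ k → τ k * (k * k))    ≤⟨ *-monoʳ-≤ 4 (∑-mono< (suc X) λ k k≤X → *-monoʳ-≤ (τ k) (*-mono-≤ (s≤s⁻¹ k≤X) (s≤s⁻¹ k≤X))) ⟩
    4 * ∑ (suc X) (λ k → τ k * (X * X))    ≡⟨ trans (cong (4 *_) (∑-*ʳ (suc X) τ (X * X))) (sym (*-assoc 4 (∑ (suc X) τ) (X * X))) ⟩
    4 * ∑ (suc X) τ * (X * X)              ≤⟨ *-monoˡ-≤ (X * X) (4∑τ≤3∑id (suc X)) ⟩
    3 * ∑ (suc X) id * (X * X)             ≡⟨ cong (λ t → 3 * t * (X * X)) (∑-id X) ⟩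
    3 * triangle X * (X * X)               ≤⟨ m≤m+n _ _ ⟩
    3 * triangle X * (X * X) + 3 * triangle X * X ≡⟨ regroup X (triangle X) ⟩
    3 * triangle X * (X * suc X)           ≡⟨ cong (3 * triangle X *_) (sym (2*triangle X)) ⟩
    3 * triangle X * (2 * triangle X)      ≡⟨ regroup′ (triangle X) ⟩
    6 * (triangle X * triangle X)          ≡⟨ cong (6 *_) (sym (∑-cubes X)) ⟩
    6 * ∑ (suc X) (λ k → k * k * k)        ≡⟨ sym (∑-*ˡ (suc X) 6 _) ⟩
    ∑ (suc X) (λ k → 6 * (k * k * k))      ∎

-- Growth of p

-- Cauchy-Schwarz read as growth: M² ≤ p Z ≤ j p² makes the increment p(j) of M at least M(j)/√j.
M≤s*p : ∀ s {j} → j ≤ s * s → M j ≤ s * p j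
M≤s*p s {j} j≤s² = sq-cancel-≤ (begin
  M j * M j              ≤⟨ M²≤pZ j ⟩
  p j * Z j              ≤⟨ *-monoʳ-≤ (p j) (≤-trans (Z≤n*p j) (*-monoˡ-≤ (p j) j≤s²)) ⟩
  p j * (s * s * p j)    ≡⟨ regroup s (p j) ⟩
  s * p j * (s * p j)    ∎)
  where
  open ≤-Reasoning
  regroup : ∀ s x → x * (s * s * x) ≡ s * x * (s * x)
  regroup = solve-∀

-- While the index stays within s², every step multiplies M by at least 1 + 1/s.
M-growth : ∀ s i {j} → i + j ≤ s * s → suc s ^ i * M j ≤ s ^ i * M (i + j)
M-growth s zero _ = ≤-refl
M-growth s (suc i) {j} i+j<s² = begin
  suc s * suc s ^ i * M j          ≡⟨ *-assoc (suc s) (suc s ^ i) (M j) ⟩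
  suc s * (suc s ^ i * M j)        ≤⟨ *-monoʳ-≤ (suc s) (M-growth s i (<⇒≤ i+j<s²)) ⟩
  suc s * (s ^ i * M (i + j))      ≡⟨ regroup s (s ^ i) (M (i + j)) ⟩
  s ^ i * (M (i + j) + s * M (i + j)) ≤⟨ *-monoʳ-≤ (s ^ i) (+-monoˡ-≤ (s * M (i + j)) (M≤s*p s (<⇒≤ i+j<s²))) ⟩
  s ^ i * (s * p (i + j) + s * M (i + j)) ≡⟨ regroup′ s (s ^ i) (p (i + j)) (M (i + j)) ⟩
  s * s ^ i * (M (i + j) + p (i + j)) ∎
  where
  open ≤-Reasoning
  regroup : ∀ s x m → suc s * (x * m) ≡ x * (m + s * m)
  regroup = solve-∀
  regroup′ : ∀ s x q m → x * (s * q + s * m) ≡ s * x * (m + q)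
  regroup′ = solve-∀

-- (1 + 1/s)ⁱ ≥ 1 + i/s + i(i-1)/(2s²), with denominators cleared and the negative term moved to the left.
bernoulli₂ : ∀ s i → s ^ i * (2 * (s * s) + 2 * (i * s) + i * i) ≤ 2 * (s * s) * suc s ^ i + i * s ^ i
bernoulli₂ s zero = ≤-reflexive (base s)
  where
  base : ∀ s → 1 * (2 * (s * s) + 0 + 0) ≡ 2 * (s * s) * 1 + 0
  base = solve-∀
bernoulli₂ s (suc i) = +-cancelʳ-≤ (i * (suc s * x) + i * i * x) _ _ (begin
  s * x * (2 * (s * s) + 2 * (suc i * s) + suc i * suc i) + (i * (suc s * x) + i * i * x)
    ≡⟨ eq₁ s i x ⟩
  suc s * (x * (2 * (s * s) + 2 * (i * s) + i * i)) + (suc i * (s * x) + i * x)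
    ≤⟨ +-mono-≤ (*-monoʳ-≤ (suc s) (bernoulli₂ s i)) (+-monoʳ-≤ (suc i * (s * x)) (*-monoˡ-≤ x (i≤i*i i))) ⟩
  suc s * (2 * (s * s) * y + i * x) + (suc i * (s * x) + i * i * x)
    ≡⟨ eq₂ s i x y ⟩
  (2 * (s * s) * (suc s * y) + suc i * (s * x)) + (i * (suc s * x) + i * i * x) ∎)
  where
  open ≤-Reasoning
  x = s ^ i
  y = suc s ^ i
  i≤i*i : ∀ i → i ≤ i * i
  i≤i*i zero = z≤n
  i≤i*i (suc i) = m≤m*n (suc i) (suc i)
  eq₁ : ∀ s i x → s * x * (2 * (s * s) + 2 * (suc i * s) + suc i * suc i) + (i * (suc s * x) + i * i * x)
    ≡ suc s * (x * (2 * (s * s) + 2 * (i * s) + i * i)) + (suc i * (s * x) + i * x)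
  eq₁ = solve-∀
  eq₂ : ∀ s i x y → suc s * (2 * (s * s) * y + i * x) + (suc i * (s * x) + i * i * x)
    ≡ (2 * (s * s) * (suc s * y) + suc i * (s * x)) + (i * (suc s * x) + i * i * x)
  eq₂ = solve-∀

-- A rational stand-in for (1 + 1/s)^(s+1) > e: one block of s+1 steps multiplies M by at least 5/2.
5s^[1+s]≤2[1+s]^[1+s] : ∀ s .{{_ : NonZero s}} → 5 * s ^ suc s ≤ 2 * suc s ^ suc s
5s^[1+s]≤2[1+s]^[1+s] s@(suc _) = *-cancelˡ-≤ (s * s) (+-cancelʳ-≤ (suc s * x) _ _ (begin
  s * s * (5 * x) + suc s * x                                    ≤⟨ m≤m+n _ (3 * s * x) ⟩
  s * s * (5 * x) + suc s * x + 3 * s * x                        ≡⟨ eq₁ s x ⟩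
  x * (2 * (s * s) + 2 * (suc s * s) + suc s * suc s)            ≤⟨ bernoulli₂ s (suc s) ⟩
  2 * (s * s) * y + suc s * x                                    ≡⟨ eq₂ s x y ⟩
  s * s * (2 * y) + suc s * x                                    ∎))
  where
  open ≤-Reasoning
  x = s ^ suc s
  y = suc s ^ suc s
  eq₁ : ∀ s x → s * s * (5 * x) + suc s * x + 3 * s * x ≡ x * (2 * (s * s) + 2 * (suc s * s) + suc s * suc s)
  eq₁ = solve-∀
  eq₂ : ∀ s x y → 2 * (s * s) * y + suc s * x ≡ s * s * (2 * y) + suc s * x
  eq₂ = solve-∀

M-growth-5/2 : ∀ s .{{_ : NonZero s}} e {j} → e * suc s + j ≤ s * s → 5 ^ e * M j ≤ 2 ^ e * M (e * suc s + j)
M-growth-5/2 s zero _ = ≤-refl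
M-growth-5/2 s@(suc _) (suc e) {j} h = begin
  5 * 5 ^ e * M j           ≡⟨ *-assoc 5 (5 ^ e) (M j) ⟩
  5 * (5 ^ e * M j)         ≤⟨ *-monoʳ-≤ 5 (M-growth-5/2 s e (≤-trans (m≤n+m _ (suc s)) h′)) ⟩
  5 * (2 ^ e * M i)         ≡⟨ swap 5 (2 ^ e) (M i) ⟩
  2 ^ e * (5 * M i)         ≤⟨ *-monoʳ-≤ (2 ^ e) 5M≤2M ⟩
  2 ^ e * (2 * M (suc s + i)) ≡⟨ swap′ (2 ^ e) (M (suc s + i)) ⟩
  2 * 2 ^ e * M (suc s + i) ≡⟨ cong (λ k → 2 * 2 ^ e * M k) (sym (+-assoc (suc s) (e * suc s) j)) ⟩
  2 * 2 ^ e * M (suc e * suc s + j) ∎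
  where
  open ≤-Reasoning
  i = e * suc s + j
  h′ : suc s + i ≤ s * s
  h′ = subst (_≤ s * s) (+-assoc (suc s) (e * suc s) j) h
  swap : ∀ a b c → a * (b * c) ≡ b * (a * c)
  swap = solve-∀
  swap′ : ∀ b c → b * (2 * c) ≡ 2 * b * c
  swap′ = solve-∀
  swap″ : ∀ a b c → a * (b * c) ≡ b * a * c
  swap″ = solve-∀
  5M≤2M : 5 * M i ≤ 2 * M (suc s + i)
  5M≤2M = *-cancelˡ-≤ (s ^ suc s) {{m^n≢0 s (suc s)}} (begin
    s ^ suc s * (5 * M i)           ≡⟨ swap″ (s ^ suc s) 5 (M i) ⟩
    5 * s ^ suc s * M i             ≤⟨ *-monoˡ-≤ (M i) (5s^[1+s]≤2[1+s]^[1+s] s) ⟩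
    2 * suc s ^ suc s * M i         ≡⟨ *-assoc 2 (suc s ^ suc s) (M i) ⟩
    2 * (suc s ^ suc s * M i)       ≤⟨ *-monoʳ-≤ 2 (M-growth s (suc s) h′) ⟩
    2 * (s ^ suc s * M (suc s + i)) ≡⟨ swap 2 (s ^ suc s) (M (suc s + i)) ⟩
    s ^ suc s * (2 * M (suc s + i)) ∎)

M-mono : ∀ {i j} → i ≤ j → M i ≤ M j
M-mono i≤j = ∑-monoˡ i≤j p

-- From u to u+1 the polynomial grows by at most (3/2)^6 = 729/64, less than 125/8; u = 10 is the
-- base case.
8^u*15[4u+6]^6≤125^u : ∀ w → 8 ^ (10 + w) * (15 * (4 * (10 + w) + 6) ^ 6) ≤ 125 ^ (10 + w)
8^u*15[4u+6]^6≤125^u zero = ≤ᵇ⇒≤ (8 ^ 10 * (15 * 46 ^ 6)) (125 ^ 10) tt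
8^u*15[4u+6]^6≤125^u (suc w) = subst (λ u → 8 ^ u * (15 * (4 * u + 6) ^ 6) ≤ 125 ^ u) (sym (+-suc 10 w)) (begin
  8 * 8 ^ u * (15 * y′ ^ 6)          ≡⟨ eq₁ (8 ^ u) (y′ ^ 6) ⟩
  8 ^ u * 15 * (8 * y′ ^ 6)          ≤⟨ *-monoʳ-≤ (8 ^ u * 15) step ⟩
  8 ^ u * 15 * (125 * y ^ 6)         ≡⟨ eq₂ (8 ^ u) (y ^ 6) ⟩
  125 * (8 ^ u * (15 * y ^ 6))       ≤⟨ *-monoʳ-≤ 125 (8^u*15[4u+6]^6≤125^u w) ⟩
  125 * 125 ^ u                      ∎)
  where
  open ≤-Reasoning
  u = 10 + w
  y = 4 * u + 6
  y′ = 4 * suc u + 6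
  eq₁ : ∀ a b → 8 * a * (15 * b) ≡ a * 15 * (8 * b)
  eq₁ = solve-∀
  eq₂ : ∀ a b → a * 15 * (125 * b) ≡ 125 * (a * (15 * b))
  eq₂ = solve-∀
  eq₃ : ∀ w → 3 * (4 * (10 + w) + 6) ≡ 2 * (4 * suc (10 + w) + 6) + (38 + 4 * w)
  eq₃ = solve-∀
  pow₂ : ∀ a → (2 * a * (2 * a * (2 * a * (2 * a * (2 * a * (2 * a * 1)))))) ≡ 64 * (a * (a * (a * (a * (a * (a * 1))))))
  pow₂ = solve-∀
  pow₃ : ∀ a → (3 * a * (3 * a * (3 * a * (3 * a * (3 * a * (3 * a * 1)))))) ≡ 729 * (a * (a * (a * (a * (a * (a * 1))))))
  pow₃ = solve-∀
  eq₄ : ∀ a → 64 * (8 * a) ≡ 8 * (64 * a)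
  eq₄ = solve-∀
  eq₅ : ∀ b → 8 * (729 * b) + 2168 * b ≡ 64 * (125 * b)
  eq₅ = solve-∀
  step : 8 * y′ ^ 6 ≤ 125 * y ^ 6
  step = *-cancelˡ-≤ 64 (begin
    64 * (8 * y′ ^ 6)    ≡⟨ eq₄ (y′ ^ 6) ⟩
    8 * (64 * y′ ^ 6)    ≡⟨ cong (8 *_) (sym (pow₂ y′)) ⟩
    8 * (2 * y′) ^ 6     ≤⟨ *-monoʳ-≤ 8 (^-monoˡ-≤ 6 (≤-trans (m≤m+n (2 * y′) _) (≤-reflexive (sym (eq₃ w))))) ⟩
    8 * (3 * y) ^ 6      ≡⟨ cong (8 *_) (pow₃ y) ⟩
    8 * (729 * y ^ 6)    ≤⟨ m≤m+n _ (2168 * y ^ 6) ⟩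
    8 * (729 * y ^ 6) + 2168 * y ^ 6 ≡⟨ eq₅ (y ^ 6) ⟩
    64 * (125 * y ^ 6)   ∎)

-- Between n/4 and n there is room for 3u blocks of s+1 steps with 4u close to s. The resulting
-- factor (5/2)^(3u) exceeds 15 s⁶, and one power of s is lost in M(n) ≤ s p(n).
15s⁵p[n/4]≤p : ∀ n r → 44 ≤ r → r * r < n → n ≤ suc r * suc r → 15 * (suc r) ^ 5 * p (n / 4) ≤ p n
15s⁵p[n/4]≤p n r 44≤r r²<n n≤s² = *-cancelˡ-≤ s (begin
  s * (15 * s ^ 5 * p m)       ≡⟨ eq₁ s (p m) ⟩
  15 * s ^ 6 * p m             ≤⟨ *-monoʳ-≤ (15 * s ^ 6) (m≤n+m (p m) (M m)) ⟩
  15 * s ^ 6 * M (suc m)       ≤⟨ *-cancelˡ-≤ (2 ^ e) {{m^n≢0 2 e}} grown ⟩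
  M (e * suc s + suc m)        ≤⟨ M-mono position ⟩
  M n                          ≤⟨ M≤s*p s n≤s² ⟩
  s * p n                      ∎)
  where
  open ≤-Reasoning
  s m u w e : ℕ
  s = suc r
  m = n / 4
  -- Chosen so that 4u(s+1) ≤ (r-2)(r+2) = r² - 4, which makes the blocks fit below n; r ≥ 44 yields
  -- u ≥ 10.
  u = (r ∸ 2) / 4
  w = u ∸ 10
  e = 3 * u
  10≤u : 10 ≤ u
  10≤u = /-monoˡ-≤ 4 (∸-monoˡ-≤ 2 44≤r)
  10+w≡u : 10 + w ≡ u
  10+w≡u = m+[n∸m]≡n 10≤u
  r≡2+ : 2 + (r ∸ 2) ≡ r
  r≡2+ = m+[n∸m]≡n (≤-trans (≤ᵇ⇒≤ 2 44 tt) 44≤r)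
  s≤4u+6 : s ≤ 4 * u + 6
  s≤4u+6 = begin
    suc r                                 ≡⟨ cong suc (sym r≡2+) ⟩
    3 + (r ∸ 2)                           ≡⟨ cong (3 +_) (m≡m%n+[m/n]*n (r ∸ 2) 4) ⟩
    3 + ((r ∸ 2) % 4 + u * 4)             ≤⟨ +-monoʳ-≤ 3 (+-monoˡ-≤ (u * 4) (s≤s⁻¹ (m%n<n (r ∸ 2) 4))) ⟩
    3 + (3 + u * 4)                       ≡⟨ eq₂ u ⟩
    4 * u + 6 ∎
    where
    eq₂ : ∀ u → 3 + (3 + u * 4) ≡ 4 * u + 6
    eq₂ = solve-∀
  eq₁ : ∀ s x → s * (15 * (s * (s * (s * (s * (s * 1))))) * x) ≡ 15 * (s * (s * (s * (s * (s * (s * 1)))))) * x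
  eq₁ = solve-∀
  numeric : 2 ^ e * (15 * s ^ 6) ≤ 5 ^ e
  numeric = subst₂ _≤_ (cong (_* (15 * s ^ 6)) (^-*-assoc 2 3 u)) (^-*-assoc 5 3 u)
    (≤-trans (*-monoʳ-≤ (8 ^ u) (*-monoʳ-≤ 15 (^-monoˡ-≤ 6 s≤4u+6)))
      (subst (λ u → 8 ^ u * (15 * (4 * u + 6) ^ 6) ≤ 125 ^ u) 10+w≡u (8^u*15[4u+6]^6≤125^u w)))
  position : e * suc s + suc m ≤ n
  position = *-cancelˡ-≤ 4 (begin
    4 * (3 * u * suc s + suc m)                     ≡⟨ eq₃ u s m ⟩
    3 * (u * 4 * suc s) + (m * 4 + 4)               ≤⟨ +-mono-≤ (*-monoʳ-≤ 3 (*-monoˡ-≤ (suc s) (m/n*n≤m (r ∸ 2) 4))) (+-monoˡ-≤ 4 (m/n*n≤m n 4)) ⟩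
    3 * ((r ∸ 2) * suc s) + (n + 4)                 ≤⟨ m≤m+n _ 8 ⟩
    3 * ((r ∸ 2) * suc s) + (n + 4) + 8             ≡⟨ eq₄ ((r ∸ 2) * suc s) n ⟩
    3 * ((r ∸ 2) * suc s + 4) + n                   ≡⟨ cong (λ x → 3 * x + n) (trans (cong (λ r′ → (r ∸ 2) * suc (suc r′) + 4) (sym r≡2+)) (trans (eq₅ (r ∸ 2)) (cong (λ x → x * x) r≡2+))) ⟩
    3 * (r * r) + n                                 ≤⟨ +-monoˡ-≤ n (*-monoʳ-≤ 3 (<⇒≤ r²<n)) ⟩
    3 * n + n                                       ≡⟨ +-comm (3 * n) n ⟩
    4 * n                                           ∎)
    where
    eq₃ : ∀ u s m → 4 * (3 * u * suc s + suc m) ≡ 3 * (u * 4 * suc s) + (m * 4 + 4)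
    eq₃ = solve-∀
    eq₄ : ∀ x n → 3 * x + (n + 4) + 8 ≡ 3 * (x + 4) + n
    eq₄ = solve-∀
    eq₅ : ∀ x → x * suc (suc (2 + x)) + 4 ≡ (2 + x) * (2 + x)
    eq₅ = solve-∀
  grown : 2 ^ e * (15 * s ^ 6 * M (suc m)) ≤ 2 ^ e * M (e * suc s + suc m)
  grown = begin
    2 ^ e * (15 * s ^ 6 * M (suc m))   ≡⟨ sym (*-assoc (2 ^ e) (15 * s ^ 6) (M (suc m))) ⟩
    2 ^ e * (15 * s ^ 6) * M (suc m)   ≤⟨ *-monoˡ-≤ (M (suc m)) numeric ⟩
    5 ^ e * M (suc m)                  ≤⟨ M-growth-5/2 s e (≤-trans position n≤s²) ⟩
    2 ^ e * M (e * suc s + suc m)      ∎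

-- The terms with k > 3n/4

far : ℕ → ℕ → ℕ
far n k = if 3 * n <ᵇ 4 * k then τ k * sh k p n else 0

tail : ℕ → ℕ
tail n = ∑ (suc n) (far n)

-- The total weight of τ has order n², at most s⁴, while each p(n-k) is at most p(n/4) ≤ p(n)/(15
-- s⁵).
100s*tail≤3p : ∀ n r → 44 ≤ r → r * r < n → n ≤ suc r * suc r → 100 * suc r * tail n ≤ 3 * p n
100s*tail≤3p n r 44≤r r²<n n≤s² = *-cancelˡ-≤ 2 (begin
  2 * (100 * s * tail n)                  ≤⟨ *-monoʳ-≤ 2 (*-monoʳ-≤ (100 * s) tail≤) ⟩
  2 * (100 * s * (∑ (suc n) τ * x))       ≡⟨ eq₁ s (∑ (suc n) τ) x ⟩
  50 * s * x * (4 * ∑ (suc n) τ)          ≤⟨ *-monoʳ-≤ (50 * s * x) (4∑τ≤3∑id (suc n)) ⟩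
  50 * s * x * (3 * ∑ (suc n) id)         ≡⟨ cong (λ t → 50 * s * x * (3 * t)) (∑-id n) ⟩
  50 * s * x * (3 * triangle n)           ≡⟨ eq₂ s x (triangle n) ⟩
  75 * s * x * (2 * triangle n)           ≡⟨ cong (75 * s * x *_) (2*triangle n) ⟩
  75 * s * x * (n * suc n)                ≤⟨ *-monoʳ-≤ (75 * s * x) (*-mono-≤ n≤s² (s≤s n≤s²)) ⟩
  75 * s * x * (s * s * suc (s * s))      ≡⟨ eq₃ s x ⟩
  15 * (s * s * s) * x * (5 * (s * s) + 5) ≤⟨ *-monoʳ-≤ (15 * (s * s * s) * x) (+-monoʳ-≤ (5 * (s * s)) 5≤s²) ⟩
  15 * (s * s * s) * x * (5 * (s * s) + s * s) ≡⟨ eq₄ s x ⟩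
  6 * (15 * s ^ 5 * x)                    ≤⟨ *-monoʳ-≤ 6 (15s⁵p[n/4]≤p n r 44≤r r²<n n≤s²) ⟩
  6 * p n                                 ≡⟨ *-assoc 2 3 (p n) ⟩
  2 * (3 * p n)                           ∎)
  where
  open ≤-Reasoning
  s = suc r
  x = p (n / 4)
  5≤s² : 5 ≤ s * s
  5≤s² = ≤-trans (≤-trans (≤ᵇ⇒≤ 5 44 tt) (m≤n⇒m≤1+n 44≤r)) (m≤m*n s s)
  eq₁ : ∀ s t x → 2 * (100 * s * (t * x)) ≡ 50 * s * x * (4 * t)
  eq₁ = solve-∀
  eq₂ : ∀ s x t → 50 * s * x * (3 * t) ≡ 75 * s * x * (2 * t)
  eq₂ = solve-∀
  eq₃ : ∀ s x → 75 * s * x * (s * s * suc (s * s)) ≡ 15 * (s * s * s) * x * (5 * (s * s) + 5)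
  eq₃ = solve-∀
  eq₄ : ∀ s x → 15 * (s * s * s) * x * (5 * (s * s) + s * s) ≡ 6 * (15 * (s * (s * (s * (s * (s * 1))))) * x)
  eq₄ = solve-∀
  eq₅ : ∀ k j → 4 * (k + j) ≡ 4 * k + j * 4
  eq₅ = solve-∀
  small : ∀ k → k ≤ n → 3 * n < 4 * k → sh k p n ≤ x
  small k k≤n 3n<4k with n ∸ k | m+[n∸m]≡n k≤n
  ... | j | refl = subst (_≤ x) (sym (sh-+ k j p)) (p-mono (subst (_≤ n / 4) (m*n/n≡m j 4) (/-monoˡ-≤ 4
    (+-cancelˡ-≤ (4 * k) _ _ (subst (_≤ 4 * k + (k + j)) (eq₅ k j) (begin
      4 * (k + j)           ≡⟨ +-comm (k + j) (3 * (k + j)) ⟩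
      3 * (k + j) + (k + j) ≤⟨ +-monoˡ-≤ (k + j) (<⇒≤ 3n<4k) ⟩
      4 * k + (k + j)       ∎))))))
  far≤ : ∀ k → k ≤ n → far n k ≤ τ k * x
  far≤ k k≤n with 3 * n <ᵇ 4 * k in eq
  ... | true  = *-monoʳ-≤ (τ k) (small k k≤n (<ᵇ⇒< (3 * n) (4 * k) (subst T (sym eq) tt)))
  ... | false = z≤n
  tail≤ : tail n ≤ ∑ (suc n) τ * x
  tail≤ = ≤-trans (∑-mono< (suc n) λ k k≤n → far≤ k (s≤s⁻¹ k≤n)) (≤-reflexive (∑-*ʳ (suc n) τ x))

-- NearConvex n says  √(p(n-1) p(n+1)) ≥ (1 - n^(-3/2)) p(n):  the fraction a/b runs over the
-- rational upper bounds of n^(-3/2).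
NearConvex : ℕ → Set
NearConvex n = ∀ a b → b * b ≤ a * a * (n * n * n) → CS (b * p (n ∸ 1)) ((b ∸ a) * p n) (b * p (suc n))

-- (1-x)^(-3/2) ≤ 5/4 + (25/2)x²  for 0 ≤ x = k/(k+j) ≤ 3/4.
near-polynomial : ∀ k j → k ≤ 3 * j → let n = k + j; g = n * n + 10 * (k * k) in
  16 * (n * n * n * n * n * n * n) ≤ 25 * (g * g * (j * j * j))
near-polynomial k j k≤3j = begin
  16 * (n * n * n * n * n * n * n)                                ≤⟨ *-monoʳ-≤ 16 n⁷≤ ⟩
  16 * (188 * m₄ + 35 * m₃ + 21 * m₂ + 7 * m₁ + m₀)               ≤⟨ +-cancelʳ-≤ (12 * m₁) _ _ linear ⟩
  25 * (121 * m₄ + 44 * m₃ + 26 * m₂ + 4 * m₁ + m₀)               ≡⟨ cong (25 *_) (sym (expand₂ k j)) ⟩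
  25 * ((n * n + 10 * (k * k)) * (n * n + 10 * (k * k)) * (j * j * j)) ∎
  where
  open ≤-Reasoning
  n = k + j
  m₀ = j * j * j * j * j * j * j
  m₁ = k * j * j * j * j * j * j
  m₂ = k * k * j * j * j * j * j
  m₃ = k * k * k * j * j * j * j
  m₄ = k * k * k * k * j * j * j
  m₅ = k * k * k * k * k * j * j
  m₆ = k * k * k * k * k * k * j
  m₇ = k * k * k * k * k * k * k
  m₇≤3m₆ : m₇ ≤ 3 * m₆
  m₇≤3m₆ = ≤-trans (*-monoʳ-≤ (k * k * k * k * k * k) k≤3j) (≤-reflexive (eq (k * k * k * k * k * k) j))
    where
    eq : ∀ x j → x * (3 * j) ≡ 3 * (x * j)
    eq = solve-∀
  m₆≤3m₅ : m₆ ≤ 3 * m₅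
  m₆≤3m₅ = ≤-trans (*-monoˡ-≤ j (*-monoʳ-≤ (k * k * k * k * k) k≤3j)) (≤-reflexive (eq (k * k * k * k * k) j))
    where
    eq : ∀ x j → x * (3 * j) * j ≡ 3 * (x * j * j)
    eq = solve-∀
  m₅≤3m₄ : m₅ ≤ 3 * m₄
  m₅≤3m₄ = ≤-trans (*-monoˡ-≤ j (*-monoˡ-≤ j (*-monoʳ-≤ (k * k * k * k) k≤3j))) (≤-reflexive (eq (k * k * k * k) j))
    where
    eq : ∀ x j → x * (3 * j) * j * j ≡ 3 * (x * j * j * j)
    eq = solve-∀
  -- From (2k - 3j)² ≥ 0. The coefficient of m₁ is the only deficient one, 16·7 against 25·4; the
  -- deficit 12 is paid with all the slack 9 of m₀ and a little of that of m₂.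
  12m₁≤4m₂+9m₀ : 12 * m₁ ≤ 4 * m₂ + 9 * m₀
  12m₁≤4m₂+9m₀ = subst₂ _≤_ (eq₁ k j) (eq₂ k j)
    (*-monoˡ-≤ (j * j * j * j * j) (2x≤y+z {2 * k * (3 * j)} {2 * k * (2 * k)} {3 * j * (3 * j)} (cs (≤-reflexive (eq₃ k j)))))
    where
    eq₁ : ∀ k j → 2 * (2 * k * (3 * j)) * (j * j * j * j * j) ≡ 12 * (k * j * j * j * j * j * j)
    eq₁ = solve-∀
    eq₂ : ∀ k j → (2 * k * (2 * k) + 3 * j * (3 * j)) * (j * j * j * j * j) ≡ 4 * (k * k * j * j * j * j * j) + 9 * (j * j * j * j * j * j * j)
    eq₂ = solve-∀
    eq₃ : ∀ k j → 2 * k * (3 * j) * (2 * k * (3 * j)) ≡ 2 * k * (2 * k) * (3 * j * (3 * j))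
    eq₃ = solve-∀
  expand₁ : ∀ k j → (k + j) * (k + j) * (k + j) * (k + j) * (k + j) * (k + j) * (k + j)
    ≡ k * k * k * k * k * k * k + 7 * (k * k * k * k * k * k * j) + 21 * (k * k * k * k * k * j * j) + 35 * (k * k * k * k * j * j * j)
      + 35 * (k * k * k * j * j * j * j) + 21 * (k * k * j * j * j * j * j) + 7 * (k * j * j * j * j * j * j) + j * j * j * j * j * j * j
  expand₁ = solve-∀
  expand₂ : ∀ k j → ((k + j) * (k + j) + 10 * (k * k)) * ((k + j) * (k + j) + 10 * (k * k)) * (j * j * j)
    ≡ 121 * (k * k * k * k * j * j * j) + 44 * (k * k * k * j * j * j * j) + 26 * (k * k * j * j * j * j * j)
      + 4 * (k * j * j * j * j * j * j) + j * j * j * j * j * j * j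
  expand₂ = solve-∀
  -- k ≤ 3j reduces the top powers to m₄: 27 + 7·9 + 21·3 + 35 = 188.
  head : m₇ + 7 * m₆ + 21 * m₅ + 35 * m₄ ≤ 188 * m₄
  head = begin
    m₇ + 7 * m₆ + 21 * m₅ + 35 * m₄      ≤⟨ +-monoˡ-≤ (35 * m₄) (+-monoˡ-≤ (21 * m₅) (+-monoˡ-≤ (7 * m₆) m₇≤3m₆)) ⟩
    3 * m₆ + 7 * m₆ + 21 * m₅ + 35 * m₄  ≡⟨ cong (λ x → x + 21 * m₅ + 35 * m₄) (sym (*-distribʳ-+ m₆ 3 7)) ⟩
    10 * m₆ + 21 * m₅ + 35 * m₄          ≤⟨ +-monoˡ-≤ (35 * m₄) (+-monoˡ-≤ (21 * m₅) (*-monoʳ-≤ 10 m₆≤3m₅)) ⟩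
    10 * (3 * m₅) + 21 * m₅ + 35 * m₄    ≡⟨ cong (_+ 35 * m₄) (trans (cong (_+ 21 * m₅) (sym (*-assoc 10 3 m₅))) (sym (*-distribʳ-+ m₅ 30 21))) ⟩
    51 * m₅ + 35 * m₄                    ≤⟨ +-monoˡ-≤ (35 * m₄) (*-monoʳ-≤ 51 m₅≤3m₄) ⟩
    51 * (3 * m₄) + 35 * m₄              ≡⟨ trans (cong (_+ 35 * m₄) (sym (*-assoc 51 3 m₄))) (sym (*-distribʳ-+ m₄ 153 35)) ⟩
    188 * m₄                             ∎
  n⁷≤ : n * n * n * n * n * n * n ≤ 188 * m₄ + 35 * m₃ + 21 * m₂ + 7 * m₁ + m₀
  n⁷≤ = ≤-trans (≤-reflexive (expand₁ k j)) (+-monoˡ-≤ m₀ (+-monoˡ-≤ (7 * m₁) (+-monoˡ-≤ (21 * m₂) (+-monoˡ-≤ (35 * m₃) head))))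
  collect : ∀ a b c d e → 16 * (188 * a + 35 * b + 21 * c + 7 * d + e) + (17 * a + 540 * b + 310 * c) + (4 * c + 9 * e)
    ≡ 25 * (121 * a + 44 * b + 26 * c + 4 * d + e) + 12 * d
  collect = solve-∀
  linear : 16 * (188 * m₄ + 35 * m₃ + 21 * m₂ + 7 * m₁ + m₀) + 12 * m₁ ≤ 25 * (121 * m₄ + 44 * m₃ + 26 * m₂ + 4 * m₁ + m₀) + 12 * m₁
  linear = ≤-trans (+-mono-≤ (m≤m+n (16 * (188 * m₄ + 35 * m₃ + 21 * m₂ + 7 * m₁ + m₀)) (17 * m₄ + 540 * m₃ + 310 * m₂)) 12m₁≤4m₂+9m₀) (≤-reflexive (collect m₄ m₃ m₂ m₁ m₀))

-- The induction step, with s = ⌈√n⌉ in place of √n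

module Step (n′ r : ℕ) (44≤r : 44 ≤ r) (r²<n : r * r < suc n′) (n≤s² : suc n′ ≤ suc r * suc r) (2000≤n : 2000 ≤ suc n′)
  (hyp : ∀ j → j < suc n′ → suc n′ ≤ 4 * j → NearConvex j) where
  open ≤-Reasoning

  n s : ℕ
  n = suc n′
  s = suc r

  E : ℕ
  E = ((λ k → τ k * (k * k)) ⋆ p) n

  -- The budget after τ ⋆ p is replaced by n p - Z, with 13 = 25 + 8 - 20. To leading order 13 + 0.6
  -- is compared with 25·4/7 > 14.2, where 0.6 comes from the tail.
  main-bound : 13 * (n * n * n * p n) + 250 * E + 20 * (s * (n * n * n) * tail n) ≤ 25 * (n * n * Z n)
  main-bound = *-cancelˡ-≤ 10 (begin
    10 * (13 * (N * p n) + 250 * E + 20 * (s * N * tail n))      ≡⟨ eq₁ N (p n) E s (tail n) ⟩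
    130 * (N * p n) + 625 * (4 * E) + 2 * (N * (100 * s * tail n)) ≤⟨ +-mono-≤ (+-monoʳ-≤ (130 * (N * p n)) (*-monoʳ-≤ 625 (τk²⋆p≤ n))) (*-monoʳ-≤ 2 (*-monoʳ-≤ N (100s*tail≤3p n r 44≤r r²<n n≤s²))) ⟩
    130 * (N * p n) + 625 * (6 * (x * Z n)) + 2 * (N * (3 * p n)) ≡⟨ eq₂ n (p n) (Z n) x ⟩
    34 * (n * n) * (4 * (n * p n)) + 2 * (1875 * x * Z n)        ≤⟨ +-mono-≤ (*-monoʳ-≤ (34 * (n * n)) (4np≤7Z n)) (*-monoʳ-≤ 2 (*-monoˡ-≤ (Z n) lower-order)) ⟩
    34 * (n * n) * (7 * Z n) + 2 * (6 * (n * n) * Z n)           ≡⟨ eq₃ n (Z n) ⟩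
    10 * (25 * (n * n * Z n))                                    ∎)
    where
    N = n * n * n
    x = 6 * n + 1
    eq₁ : ∀ N p E s t → 10 * (13 * (N * p) + 250 * E + 20 * (s * N * t)) ≡ 130 * (N * p) + 625 * (4 * E) + 2 * (N * (100 * s * t))
    eq₁ = solve-∀
    eq₂ : ∀ n p z x → 130 * (n * n * n * p) + 625 * (6 * (x * z)) + 2 * (n * n * n * (3 * p)) ≡ 34 * (n * n) * (4 * (n * p)) + 2 * (1875 * x * z)
    eq₂ = solve-∀
    eq₃ : ∀ n z → 34 * (n * n) * (7 * z) + 2 * (6 * (n * n) * z) ≡ 10 * (25 * (n * n * z))
    eq₃ = solve-∀
    -- True from n = 1876 on; this requires a threshold of the order of 2000.
    lower-order : 1875 * (6 * n + 1) ≤ 6 * (n * n)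
    lower-order = begin
      1875 * (6 * n + 1)         ≡⟨ trans (*-distribˡ-+ 1875 (6 * n) 1) (cong (_+ 1875) (sym (*-assoc 1875 6 n))) ⟩
      11250 * n + 1875           ≤⟨ +-monoʳ-≤ (11250 * n) (≤-trans (≤ᵇ⇒≤ 1875 2000 tt) (≤-trans 2000≤n (m≤n*m n 750))) ⟩
      11250 * n + 750 * n        ≡⟨ sym (*-distribʳ-+ n 11250 750) ⟩
      12000 * n                  ≡⟨ *-assoc 6 2000 n ⟩
      6 * (2000 * n)             ≤⟨ *-monoʳ-≤ 6 (*-monoˡ-≤ n 2000≤n) ⟩
      6 * (n * n)                ∎

  44r≤n : 44 * r ≤ n
  44r≤n = ≤-trans (*-monoˡ-≤ r 44≤r) (<⇒≤ r²<n)

  -- (M/Z)² ≤ p/Z ≤ 7/(4n). Rounding √(7/4) up to 7/5 pays for replacing n by s², since 25 s² ≤ 28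
  -- n.
  5sM≤7Z : 5 * s * M n ≤ 7 * Z n
  5sM≤7Z = sq-cancel-≤ (begin
    5 * s * M n * (5 * s * M n)       ≡⟨ eq₁ s (M n) ⟩
    25 * (s * s) * (M n * M n)        ≤⟨ *-mono-≤ 25s²≤28n (M²≤pZ n) ⟩
    28 * n * (p n * Z n)              ≡⟨ eq₂ n (p n) (Z n) ⟩
    7 * Z n * (4 * (n * p n))         ≤⟨ *-monoʳ-≤ (7 * Z n) (4np≤7Z n) ⟩
    7 * Z n * (7 * Z n)               ∎)
    where
    eq₁ : ∀ s m → 5 * s * m * (5 * s * m) ≡ 25 * (s * s) * (m * m)
    eq₁ = solve-∀
    eq₂ : ∀ n p z → 28 * n * (p * z) ≡ 7 * z * (4 * (n * p))
    eq₂ = solve-∀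
    eq₃ : ∀ r → 25 * (suc r * suc r) ≡ 25 * (r * r) + (50 * r + 25)
    eq₃ = solve-∀
    eq₄ : ∀ r → 50 * r + r ≡ 51 * r
    eq₄ = solve-∀
    eq₅ : ∀ x → 25 * x + 3 * x ≡ 28 * x
    eq₅ = solve-∀
    25s²≤28n : 25 * (s * s) ≤ 28 * n
    25s²≤28n = begin
      25 * (suc r * suc r)            ≡⟨ eq₃ r ⟩
      25 * (r * r) + (50 * r + 25)    ≤⟨ +-monoʳ-≤ (25 * (r * r)) (+-monoʳ-≤ (50 * r) (≤-trans (≤ᵇ⇒≤ 25 44 tt) 44≤r)) ⟩
      25 * (r * r) + (50 * r + r)     ≡⟨ cong (25 * (r * r) +_) (eq₄ r) ⟩
      25 * (r * r) + 51 * r           ≤⟨ +-mono-≤ (*-monoʳ-≤ 25 (<⇒≤ r²<n)) (≤-trans (*-monoˡ-≤ r (≤ᵇ⇒≤ 51 132 tt)) (≤-trans (≤-reflexive (*-assoc 3 44 r)) (*-monoʳ-≤ 3 44r≤n))) ⟩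
      25 * n + 3 * n                  ≡⟨ eq₅ n ⟩
      28 * n                          ∎

  26sp≤5Z : 26 * s * p n ≤ 5 * Z n
  26sp≤5Z = *-cancelˡ-≤ 7 (begin
    7 * (26 * s * p n)          ≡⟨ eq₁ s (p n) ⟩
    182 * s * p n               ≤⟨ *-monoˡ-≤ (p n) 182s≤20n ⟩
    20 * n * p n                ≡⟨ eq₂ n (p n) ⟩
    5 * (4 * (n * p n))         ≤⟨ *-monoʳ-≤ 5 (4np≤7Z n) ⟩
    5 * (7 * Z n)               ≡⟨ eq₃ (Z n) ⟩
    7 * (5 * Z n)               ∎)
    where
    eq₁ : ∀ s p → 7 * (26 * s * p) ≡ 182 * s * p
    eq₁ = solve-∀
    eq₂ : ∀ n p → 20 * n * p ≡ 5 * (4 * (n * p))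
    eq₂ = solve-∀
    eq₃ : ∀ z → 5 * (7 * z) ≡ 7 * (5 * z)
    eq₃ = solve-∀
    eq₅ : ∀ r → 182 * suc r ≡ 182 + 182 * r
    eq₅ = solve-∀
    eq₆ : ∀ r → 182 * r + 182 * r ≡ 364 * r
    eq₆ = solve-∀
    182s≤20n : 182 * s ≤ 20 * n
    182s≤20n = begin
      182 * suc r            ≡⟨ eq₅ r ⟩
      182 + 182 * r          ≤⟨ +-monoˡ-≤ (182 * r) (*-monoʳ-≤ 182 (≤-trans (≤ᵇ⇒≤ 1 44 tt) 44≤r)) ⟩
      182 * r + 182 * r      ≡⟨ eq₆ r ⟩
      364 * r                ≤⟨ *-monoˡ-≤ r (≤ᵇ⇒≤ 364 880 tt) ⟩
      880 * r                ≡⟨ *-assoc 20 44 r ⟩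
      20 * (44 * r)          ≤⟨ *-monoʳ-≤ 20 44r≤n ⟩
      20 * n                 ∎

  2p≤5sZ : 2 * p n ≤ 5 * s * Z n
  2p≤5sZ = begin
    2 * p n          ≤⟨ *-monoˡ-≤ (p n) (≤-trans (≤ᵇ⇒≤ 2 26 tt) (m≤m*n 26 s)) ⟩
    26 * s * p n     ≤⟨ 26sp≤5Z ⟩
    5 * Z n          ≤⟨ *-monoˡ-≤ (Z n) (m≤m*n 5 s) ⟩
    5 * s * Z n      ∎

  w : ℕ
  w = 5 * s * Z n ∸ 2 * p n

  w+2p : w + 2 * p n ≡ 5 * s * Z n
  w+2p = m∸n+n≡m 2p≤5sZ

  -- By definition Z(n-1) = Z - M and Z(n+1) = Z + M + p, so their product is at least Z² -
  -- p(M+p)/2. The claimed root is `w`/(5s) = Z - 2p/(5s); comparing squares leaves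
  -- `25s²[M+p]≤8w+8p`.
  CS-Z : CS (5 * s * Z n′) w (5 * s * Z (suc n))
  CS-Z = cs (*-cancelˡ-≤ 2 (+-cancelʳ-≤ slack _ _ (begin
    2 * (w * w) + slack
      ≡⟨ eq₁ w (p n) (s * s) (M n) ⟩
    2 * ((w + 2 * p n) * (w + 2 * p n)) + (25 * (s * s) * (2 * (M n * M n) + p n * M n) + 25 * (s * s) * (p n * M n))
      ≡⟨ cong (λ x → 2 * (x * x) + (25 * (s * s) * (2 * (M n * M n) + p n * M n) + 25 * (s * s) * (p n * M n))) w+2p ⟩
    2 * (5 * s * Z n * (5 * s * Z n)) + (25 * (s * s) * (2 * (M n * M n) + p n * M n) + 25 * (s * s) * (p n * M n))
      ≤⟨ +-monoʳ-≤ (2 * (5 * s * Z n * (5 * s * Z n))) (+-monoˡ-≤ _ (*-monoʳ-≤ (25 * (s * s)) (2M²+pM≤2pZ+p² n))) ⟩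
    2 * (5 * s * Z n * (5 * s * Z n)) + (25 * (s * s) * (2 * (p n * Z n) + p n * p n) + 25 * (s * s) * (p n * M n))
      ≡⟨ eq₂ s (Z n) (p n) (M n) ⟩
    2 * (5 * s * Z n * (5 * s * Z n)) + 50 * (s * s) * (p n * Z n) + p n * (25 * (s * s) * (M n + p n))
      ≤⟨ +-monoʳ-≤ (2 * (5 * s * Z n * (5 * s * Z n)) + 50 * (s * s) * (p n * Z n)) (*-monoʳ-≤ (p n) 25s²[M+p]≤8w+8p) ⟩
    2 * (5 * s * Z n * (5 * s * Z n)) + 50 * (s * s) * (p n * Z n) + p n * (8 * w + 8 * p n)
      ≡⟨ eq₃ s (Z n′) (M n) (p n) w ⟩
    2 * (5 * s * Z n′ * (5 * s * Z (suc n))) + slack ∎)))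
    where
    slack = (8 * (w * p n) + 8 * (p n * p n)) + (50 * (s * s) * (M n * M n) + 50 * (s * s) * (p n * M n))
    eq₁ : ∀ w p S M → 2 * (w * w) + ((8 * (w * p) + 8 * (p * p)) + (50 * S * (M * M) + 50 * S * (p * M)))
      ≡ 2 * ((w + 2 * p) * (w + 2 * p)) + (25 * S * (2 * (M * M) + p * M) + 25 * S * (p * M))
    eq₁ = solve-∀
    eq₂ : ∀ s z p M → 2 * (5 * s * z * (5 * s * z)) + (25 * (s * s) * (2 * (p * z) + p * p) + 25 * (s * s) * (p * M))
      ≡ 2 * (5 * s * z * (5 * s * z)) + 50 * (s * s) * (p * z) + p * (25 * (s * s) * (M + p))
    eq₂ = solve-∀
    eq₃ : ∀ s z M p w → 2 * (5 * s * (z + M) * (5 * s * (z + M))) + 50 * (s * s) * (p * (z + M)) + p * (8 * w + 8 * p)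
      ≡ 2 * (5 * s * z * (5 * s * ((z + M) + (M + p)))) + ((8 * (w * p) + 8 * (p * p)) + (50 * (s * s) * (M * M) + 50 * (s * s) * (p * M)))
    eq₃ = solve-∀
    eq₄ : ∀ s M p → 25 * (s * s) * (M + p) + 8 * p ≡ 5 * s * (5 * s * M) + (25 * (s * s) + 8) * p
    eq₄ = solve-∀
    eq₅ : ∀ s z p → 5 * s * (7 * z) + (25 * (s * s) + s * s) * p ≡ 35 * s * z + s * (26 * s * p)
    eq₅ = solve-∀
    eq₆ : ∀ s z → 35 * s * z + s * (5 * z) ≡ 8 * (5 * s * z)
    eq₆ = solve-∀
    eq₇ : ∀ w p → 8 * (w + 2 * p) ≡ 8 * w + 8 * p + 8 * p
    eq₇ = solve-∀
    25s²[M+p]≤8w+8p : 25 * (s * s) * (M n + p n) ≤ 8 * w + 8 * p n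
    25s²[M+p]≤8w+8p = +-cancelʳ-≤ (8 * p n) _ _ (begin
      25 * (s * s) * (M n + p n) + 8 * p n                   ≡⟨ eq₄ s (M n) (p n) ⟩
      5 * s * (5 * s * M n) + (25 * (s * s) + 8) * p n       ≤⟨ +-mono-≤ (*-monoʳ-≤ (5 * s) 5sM≤7Z) (*-monoˡ-≤ (p n) (+-monoʳ-≤ (25 * (s * s)) 8≤s²)) ⟩
      5 * s * (7 * Z n) + (25 * (s * s) + s * s) * p n       ≡⟨ eq₅ s (Z n) (p n) ⟩
      35 * s * Z n + s * (26 * s * p n)                      ≤⟨ +-monoʳ-≤ (35 * s * Z n) (*-monoʳ-≤ s 26sp≤5Z) ⟩
      35 * s * Z n + s * (5 * Z n)                           ≡⟨ eq₆ s (Z n) ⟩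
      8 * (5 * s * Z n)                                      ≡⟨ cong (8 *_) (sym w+2p) ⟩
      8 * (w + 2 * p n)                                      ≡⟨ eq₇ w (p n) ⟩
      8 * w + 8 * p n + 8 * p n                              ∎)
      where
      8≤s² : 8 ≤ s * s
      8≤s² = ≤-trans (≤-trans (≤ᵇ⇒≤ 8 44 tt) (m≤n⇒m≤1+n 44≤r)) (m≤m*n s s)

  module _ (a b : ℕ) (b²≤a²n³ : b * b ≤ a * a * (n * n * n)) where
    -- `L` and `A k` are denominator and numerator of (5/4 + (25/2)(k/n)²) a/b, the rational upper
    -- bound for f(n-k) at which the hypothesis is used.
    L : ℕ
    L = 4 * (n * n) * b

    A : ℕ → ℕ
    A k = a * (5 * (n * n + 10 * (k * k)))

    -- Lower bound for L √(p(n-1-k) p(n+1-k)). For k > 3n/4 the trivial bound 0 is taken, and the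
    -- loss is charged to `tail`.
    c : ℕ → ℕ
    c k = if 3 * n <ᵇ 4 * k then 0 else (L ∸ A k) * sh k p n

    near : ∀ k → 0 < k → ¬ (3 * n < 4 * k) → CS (L * sh k p n′) ((L ∸ A k) * sh k p n) (L * sh k p (suc n))
    near k 0<k 3n≮4k with n ∸ k | m+[n∸m]≡n {k} {n} k≤n
      where
      k≤n : k ≤ n
      k≤n = *-cancelˡ-≤ 4 (≤-trans (≮⇒≥ 3n≮4k) (*-monoˡ-≤ n (≤ᵇ⇒≤ 3 4 tt)))
    ... | zero | k+0≡n = contradiction (subst (λ m → 3 * m < 4 * k) k+0≡n (subst (λ m → 3 * m < 4 * k) (sym (+-identityʳ k)) (*-monoˡ-< k {{>-nonZero 0<k}} (≤ᵇ⇒≤ 4 4 tt)))) 3n≮4k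
    ... | suc j′ | k+j≡n = subst₂ (λ x z → CS (L * x) ((L ∸ A k) * sh k p n) (L * z)) x≡ z≡
      (subst (λ y → CS (L * p j′) ((L ∸ A k) * y) (L * p (suc j))) y≡ (hyp j j<n n≤4j (A k) L bound))
      where
      j = suc j′
      n′≡k+j′ : k + j′ ≡ n′
      n′≡k+j′ = suc-injective (trans (sym (+-suc k j′)) k+j≡n)
      x≡ : p j′ ≡ sh k p n′
      x≡ = trans (sym (sh-+ k j′ p)) (cong (sh k p) n′≡k+j′)
      y≡ : p j ≡ sh k p n
      y≡ = trans (sym (sh-+ k j p)) (cong (sh k p) k+j≡n)
      z≡ : p (suc j) ≡ sh k p (suc n)
      z≡ = trans (sym (sh-+ k (suc j) p)) (cong (sh k p) (trans (+-suc k j) (cong suc k+j≡n)))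
      j<n : j < n
      j<n = subst (j <_) k+j≡n (+-monoˡ-≤ j 0<k)
      k≤3j : k ≤ 3 * j
      k≤3j = +-cancelˡ-≤ (3 * k) _ _ (≤-trans (≤-reflexive (+-comm (3 * k) k)) (≤-trans (≮⇒≥ 3n≮4k) (≤-reflexive (trans (cong (3 *_) (sym k+j≡n)) (*-distribˡ-+ 3 k j)))))
      n≤4j : n ≤ 4 * j
      n≤4j = subst (_≤ 4 * j) k+j≡n (≤-trans (+-monoˡ-≤ j k≤3j) (≤-reflexive (+-comm (3 * j) j)))
      eq₁ : ∀ n b → 4 * (n * n) * b * (4 * (n * n) * b) ≡ 16 * (n * n * n * n) * (b * b)
      eq₁ = solve-∀
      eq₂ : ∀ n a → 16 * (n * n * n * n) * (a * a * (n * n * n)) ≡ a * a * (16 * (n * n * n * n * n * n * n))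
      eq₂ = solve-∀
      eq₃ : ∀ a g j → a * a * (25 * (g * g * j)) ≡ a * (5 * g) * (a * (5 * g)) * j
      eq₃ = solve-∀
      g = n * n + 10 * (k * k)
      bound : L * L ≤ A k * A k * (j * j * j)
      bound = begin
        L * L                                              ≡⟨ eq₁ n b ⟩
        16 * (n * n * n * n) * (b * b)                     ≤⟨ *-monoʳ-≤ (16 * (n * n * n * n)) b²≤a²n³ ⟩
        16 * (n * n * n * n) * (a * a * (n * n * n))       ≡⟨ eq₂ n a ⟩
        a * a * (16 * (n * n * n * n * n * n * n))         ≤⟨ *-monoʳ-≤ (a * a) (subst (λ m → let g = m * m + 10 * (k * k) in 16 * (m * m * m * m * m * m * m) ≤ 25 * (g * g * (j * j * j))) k+j≡n (near-polynomial k j k≤3j)) ⟩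
        a * a * (25 * (g * g * (j * j * j)))               ≡⟨ eq₃ a g (j * j * j) ⟩
        A k * A k * (j * j * j)                            ∎

    term : ∀ k → CS (τ k * (L * sh k p n′)) (τ k * c k) (τ k * (L * sh k p (suc n)))
    term zero = cs z≤n
    term k@(suc _) = CS-scale (τ k) each
      where
      each : CS (L * sh k p n′) (c k) (L * sh k p (suc n))
      each with 3 * n <ᵇ 4 * k in eq
      ... | true  = cs z≤n
      ... | false = near k z<s λ 3n<4k → subst T eq (<⇒<ᵇ 3n<4k)

    -- A common range for the convolutions at n-1, n and n+1; surplus terms vanish.
    K : ℕ
    K = suc (suc n)

    Y : ℕ
    Y = ∑ K (λ k → τ k * c k)

    CS-Y : CS (L * (τ ⋆ p) n′) Y (L * (τ ⋆ p) (suc n))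
    CS-Y = subst₂ (λ x z → CS x Y z) (pull n′ (m≤n⇒m≤1+n (n≤1+n n))) (pull (suc n) ≤-refl) (CS-∑ K λ k _ → term k)
      where
      swap : ∀ t l x → t * (l * x) ≡ l * (t * x)
      swap = solve-∀
      pull : ∀ m → m < K → ∑ K (λ k → τ k * (L * sh k p m)) ≡ L * (τ ⋆ p) m
      pull m m<K = trans (∑-cong K λ k → swap (τ k) L (sh k p m)) (trans (∑-*ˡ K L _) (cong (L *_) (⋆-extend τ p m<K)))

    -- A near term loses `A k`, also when the truncated `L ∸ A k` is 0; a far term loses its full
    -- weight `L`.
    Y-lower : L * (τ ⋆ p) n ≤ Y + a * (5 * (n * n) * (τ ⋆ p) n + 50 * E) + L * tail n
    Y-lower = begin
      L * (τ ⋆ p) n                          ≡⟨ sym (∑-*ˡ (suc n) L _) ⟩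
      ∑ (suc n) (λ k → L * (τ k * sh k p n)) ≤⟨ ∑-mono (suc n) pointwise ⟩
      ∑ (suc n) (λ k → τ k * c k + rest k + L * far n k)
        ≡⟨ trans (∑-+ (suc n) _ _) (cong₂ _+_ (∑-+ (suc n) _ rest) (∑-*ˡ (suc n) L (far n))) ⟩
      ∑ (suc n) (λ k → τ k * c k) + ∑ (suc n) rest + L * tail n
        ≤⟨ +-monoˡ-≤ (L * tail n) (+-monoˡ-≤ (∑ (suc n) rest) (m≤m+n (∑ (suc n) (λ k → τ k * c k)) (τ (suc n) * c (suc n)))) ⟩
      Y + ∑ (suc n) rest + L * tail n
        ≡⟨ cong (λ x → Y + x + L * tail n) (trans (∑-*ˡ (suc n) a _) (cong (a *_) (trans (∑-+ (suc n) _ _) (cong₂ _+_ (∑-*ˡ (suc n) (5 * (n * n)) _) (∑-*ˡ (suc n) 50 _))))) ⟩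
      Y + a * (5 * (n * n) * (τ ⋆ p) n + 50 * E) + L * tail n ∎
      where
      rest : ℕ → ℕ
      rest k = a * (5 * (n * n) * (τ k * sh k p n) + 50 * (τ k * (k * k) * sh k p n))
      eq₁ : ∀ t y x A → t * (x * y) + A * (t * y) ≡ (A + x) * (t * y)
      eq₁ = solve-∀
      eq₂ : ∀ a N k t y → a * (5 * (N + 10 * (k * k))) * (t * y) ≡ a * (5 * N * (t * y) + 50 * (t * (k * k) * y))
      eq₂ = solve-∀
      pointwise : ∀ k → L * (τ k * sh k p n) ≤ τ k * c k + rest k + L * far n k
      pointwise k with 3 * n <ᵇ 4 * k
      ... | true  = m≤n+m _ (τ k * 0 + rest k)
      ... | false = begin
        L * (τ k * y)                                  ≤⟨ *-monoˡ-≤ (τ k * y) (m≤n+m∸n L (A k)) ⟩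
        (A k + (L ∸ A k)) * (τ k * y)                  ≡⟨ sym (eq₁ (τ k) y (L ∸ A k) (A k)) ⟩
        τ k * ((L ∸ A k) * y) + A k * (τ k * y)        ≡⟨ cong (τ k * ((L ∸ A k) * y) +_) (eq₂ a (n * n) k (τ k) y) ⟩
        τ k * ((L ∸ A k) * y) + rest k                 ≤⟨ m≤m+n _ (L * 0) ⟩
        τ k * ((L ∸ A k) * y) + rest k + L * 0         ∎
        where y = sh k p n

    -- b ≤ a n^(3/2) and √n ≤ s. It makes the tail and bracket losses, which are multiples of b p/s,
    -- comparable with multiples of a.
    b≤ans : b ≤ a * (n * s)
    b≤ans = sq-cancel-≤ (begin
      b * b                              ≤⟨ b²≤a²n³ ⟩
      a * a * (n * n * n)                ≤⟨ *-monoʳ-≤ (a * a) (*-monoʳ-≤ (n * n) n≤s²) ⟩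
      a * a * (n * n * (s * s))          ≡⟨ eq a n s ⟩
      a * (n * s) * (a * (n * s))        ∎)
      where
      eq : ∀ a n s → a * a * (n * n * (s * s)) ≡ a * (n * s) * (a * (n * s))
      eq = solve-∀

    -- Near terms, far terms and bracket together stay within n a p(n), everything scaled by 20 s
    -- n².
    total-loss : 5 * s * (a * (5 * (n * n) * (τ ⋆ p) n + 50 * E)) + L * (5 * s * tail n + 2 * p n) ≤ 20 * s * (n * n * n) * (a * p n)
    total-loss = begin
      5 * s * (a * (5 * (n * n) * t + 50 * E)) + 4 * (n * n) * b * (5 * s * tail n + 2 * p n)
        ≤⟨ +-monoʳ-≤ (5 * s * (a * (5 * (n * n) * t + 50 * E))) (*-monoˡ-≤ (5 * s * tail n + 2 * p n) (*-monoʳ-≤ (4 * (n * n)) b≤ans)) ⟩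
      5 * s * (a * (5 * (n * n) * t + 50 * E)) + 4 * (n * n) * (a * (n * s)) * (5 * s * tail n + 2 * p n)
        ≡⟨ eq₁ s a n t E (tail n) (p n) ⟩
      s * a * (25 * (n * n) * t + (250 * E + 20 * (s * (n * n * n) * tail n) + 8 * (n * n * n * p n)))
        ≤⟨ *-monoʳ-≤ (s * a) inner ⟩
      s * a * (20 * (n * n * n * p n))
        ≡⟨ eq₂ s a (n * n * n) (p n) ⟩
      20 * s * (n * n * n) * (a * p n) ∎
      where
      t = (τ ⋆ p) n
      eq₁ : ∀ s a n t E u q → 5 * s * (a * (5 * (n * n) * t + 50 * E)) + 4 * (n * n) * (a * (n * s)) * (5 * s * u + 2 * q)
        ≡ s * a * (25 * (n * n) * t + (250 * E + 20 * (s * (n * n * n) * u) + 8 * (n * n * n * q)))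
      eq₁ = solve-∀
      eq₂ : ∀ s a N q → s * a * (20 * (N * q)) ≡ 20 * s * N * (a * q)
      eq₂ = solve-∀
      eq₃ : ∀ n t z R q → 25 * (n * n) * t + (R + 8 * q) + 25 * (n * n * z) ≡ 25 * (n * n) * (z + t) + (R + 8 * q)
      eq₃ = solve-∀
      eq₄ : ∀ n q E U → 25 * (n * n) * (n * q) + ((250 * E + U) + 8 * (n * n * n * q)) ≡ 20 * (n * n * n * q) + (13 * (n * n * n * q) + 250 * E + U)
      eq₄ = solve-∀
      U = 20 * (s * (n * n * n) * tail n)
      inner : 25 * (n * n) * t + (250 * E + U + 8 * (n * n * n * p n)) ≤ 20 * (n * n * n * p n)
      inner = +-cancelʳ-≤ (25 * (n * n * Z n)) _ _ (begin
        25 * (n * n) * t + (250 * E + U + 8 * (n * n * n * p n)) + 25 * (n * n * Z n)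
          ≡⟨ eq₃ n t (Z n) (250 * E + U) (n * n * n * p n) ⟩
        25 * (n * n) * (Z n + t) + (250 * E + U + 8 * (n * n * n * p n))
          ≡⟨ cong (λ x → 25 * (n * n) * x + (250 * E + U + 8 * (n * n * n * p n))) (sym (n*p≡Z+τ⋆p n)) ⟩
        25 * (n * n) * (n * p n) + (250 * E + U + 8 * (n * n * n * p n))
          ≡⟨ eq₄ n (p n) E U ⟩
        20 * (n * n * n * p n) + (13 * (n * n * n * p n) + 250 * E + U)
          ≤⟨ +-monoʳ-≤ (20 * (n * n * n * p n)) main-bound ⟩
        20 * (n * n * n * p n) + 25 * (n * n * Z n) ∎)

    middle : a ≤ b → 20 * s * (n * n) * (n * ((b ∸ a) * p n)) ≤ 5 * s * Y + L * w
    middle a≤b = +-cancelʳ-≤ loss _ _ (begin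
      20 * s * (n * n) * (n * (d * p n)) + loss
        ≤⟨ +-monoʳ-≤ (20 * s * (n * n) * (n * (d * p n))) total-loss ⟩
      20 * s * (n * n) * (n * (d * p n)) + 20 * s * (n * n * n) * (a * p n)
        ≡⟨ eq₁ s n d a (p n) ⟩
      5 * s * (4 * (n * n) * (a + d)) * (n * p n)
        ≡⟨ cong₂ (λ x y → 5 * s * (4 * (n * n) * x) * y) (m+[n∸m]≡n a≤b) (n*p≡Z+τ⋆p n) ⟩
      5 * s * L * (Z n + t)
        ≡⟨ eq₂ s L (Z n) t ⟩
      5 * s * (L * t) + L * (5 * s * Z n)
        ≡⟨ cong (λ x → 5 * s * (L * t) + L * x) (sym w+2p) ⟩
      5 * s * (L * t) + L * (w + 2 * p n)
        ≤⟨ +-monoˡ-≤ (L * (w + 2 * p n)) (*-monoʳ-≤ (5 * s) Y-lower) ⟩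
      5 * s * (Y + a * (5 * (n * n) * t + 50 * E) + L * tail n) + L * (w + 2 * p n)
        ≡⟨ eq₃ s Y (a * (5 * (n * n) * t + 50 * E)) L (tail n) w (p n) ⟩
      5 * s * Y + L * w + loss ∎)
      where
      d = b ∸ a
      t = (τ ⋆ p) n
      loss = 5 * s * (a * (5 * (n * n) * t + 50 * E)) + L * (5 * s * tail n + 2 * p n)
      eq₁ : ∀ s n d a q → 20 * s * (n * n) * (n * (d * q)) + 20 * s * (n * n * n) * (a * q) ≡ 5 * s * (4 * (n * n) * (a + d)) * (n * q)
      eq₁ = solve-∀
      eq₂ : ∀ s L z t → 5 * s * L * (z + t) ≡ 5 * s * (L * t) + L * (5 * s * z)
      eq₂ = solve-∀
      eq₃ : ∀ s Y x L u w q → 5 * s * (Y + x + L * u) + L * (w + 2 * q) ≡ 5 * s * Y + L * w + (5 * s * x + L * (5 * s * u + 2 * q))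
      eq₃ = solve-∀

    CS-total : CS (20 * s * (n * n) * (b * (n′ * p n′))) (5 * s * Y + L * w) (20 * s * (n * n) * (b * (suc n * p (suc n))))
    CS-total = subst₂ (λ x z → CS x (5 * s * Y + L * w) z) (collect n′) (collect (suc n)) (CS-add (CS-scale (5 * s) CS-Y) (CS-scale L CS-Z))
      where
      eq : ∀ s N b z t → 5 * s * (4 * N * b * t) + 4 * N * b * (5 * s * z) ≡ 20 * s * N * (b * (z + t))
      eq = solve-∀
      collect : ∀ m → 5 * s * (L * (τ ⋆ p) m) + L * (5 * s * Z m) ≡ 20 * s * (n * n) * (b * (m * p m))
      collect m = trans (eq s (n * n) b (Z m) ((τ ⋆ p) m)) (cong (λ x → 20 * s * (n * n) * (b * x)) (sym (n*p≡Z+τ⋆p m)))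

    conclusion : CS (b * p n′) ((b ∸ a) * p n) (b * p (suc n))
    conclusion with a ≤? b
    ... | no  a≰b = subst (λ d → CS (b * p n′) (d * p n) (b * p (suc n))) (sym (m≤n⇒m∸n≡0 (<⇒≤ (≰⇒> a≰b)))) (cs z≤n)
    ... | yes a≤b = cs (*-cancelˡ-≤ (F * F * (n * n)) (begin
      F * F * (n * n) * (d * d)                                ≡⟨ eq₁ F n d ⟩
      F * (n * d) * (F * (n * d))                              ≤⟨ *-mono-≤ (middle a≤b) (middle a≤b) ⟩
      (5 * s * Y + L * w) * (5 * s * Y + L * w)                ≤⟨ CS.b²≤ac CS-total ⟩
      F * (b * (n′ * p n′)) * (F * (b * (suc n * p (suc n))))  ≡⟨ eq₂ F b n′ (p n′) (p (suc n)) ⟩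
      -- The weights n-1 and n+1 are removed by (n-1)(n+1) ≤ n².
      F * F * (n′ * suc n) * (b * p n′ * (b * p (suc n)))      ≤⟨ *-monoˡ-≤ _ (*-monoʳ-≤ (F * F) (≤-trans (m≤m+n _ 1) (≤-reflexive (eq₃ n′)))) ⟩
      F * F * (n * n) * (b * p n′ * (b * p (suc n)))           ∎))
      where
      d = (b ∸ a) * p n
      F = 20 * s * (n * n)
      eq₁ : ∀ F n d → F * F * (n * n) * (d * d) ≡ F * (n * d) * (F * (n * d))
      eq₁ = solve-∀
      eq₂ : ∀ F b m x y → F * (b * (m * x)) * (F * (b * (suc (suc m) * y))) ≡ F * F * (m * suc (suc m)) * (b * x * (b * y))
      eq₂ = solve-∀
      eq₃ : ∀ m → m * suc (suc m) + 1 ≡ suc m * suc m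
      eq₃ = solve-∀

-- Verification for n < 2000, tabulating p with the recurrence n p(n) = Σ σ(k) p(n-k)

dot : List ℕ → List ℕ → ℕ → ℕ
dot (x ∷ xs) (y ∷ ys) acc = dot xs ys (x * y + acc)
dot _ _ acc = acc

history : (ℕ → ℕ) → ℕ → List ℕ
history q zero = q 0 ∷ []
history q (suc n) = q (suc n) ∷ history q n

-- With the values of q listed backwards a convolution is a dot product. `dot` stops at the shorter
-- list, so one list of weights serves all n < N.
dot-history : ∀ f q n N acc → n < N → dot (applyUpTo f N) (history q n) acc ≡ (f ⋆ q) n + acc
dot-history f q zero (suc N) acc _ = nil (applyUpTo (f ∘ suc) N) (f 0 * q 0 + acc)
  where
  nil : ∀ xs acc → dot xs [] acc ≡ acc
  nil [] acc = refl
  nil (_ ∷ _) acc = refl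
dot-history f q (suc n) (suc N) acc (s≤s n<N) = begin
  dot (applyUpTo (f ∘ suc) N) (history q n) (f 0 * q (suc n) + acc)  ≡⟨ dot-history (f ∘ suc) q n N _ n<N ⟩
  ((f ∘ suc) ⋆ q) n + (f 0 * q (suc n) + acc)                        ≡⟨ regroup (((f ∘ suc) ⋆ q) n) (f 0 * q (suc n)) acc ⟩
  f 0 * q (suc n) + ((f ∘ suc) ⋆ q) n + acc                          ≡⟨ cong (_+ acc) (sym (⋆-suc f q n)) ⟩
  (f ⋆ q) (suc n) + acc                                              ∎
  where
  open ≡-Reasoning
  regroup : ∀ x y z → x + (y + z) ≡ y + x + z
  regroup = solve-∀

checkSmall checkLarge check : ℕ → ℕ → ℕ → ℕ → Bool
checkSmall n x y z = (y * y ≤ᵇ x * z) ∨ ((x * z <ᵇ y * y) ∧ ((y * y ∸ x * z) ^ 2 * (24 * n) ^ 3 <ᵇ (240 * (x * z)) ^ 2))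
-- 22/n² ≤ n^(-3/2) since 22² ≤ 500 ≤ n.
checkLarge n x y z = (n * n ∸ 22) * y * ((n * n ∸ 22) * y) ≤ᵇ n * n * x * (n * n * z)
-- From 500 on the stronger bound is tested, because the induction step at n ≥ 2000 uses its
-- hypothesis at indices j ≥ n/4 ≥ 500.
check n x y z = if n <ᵇ 500 then (n ≤ᵇ 6) ∨ checkSmall n x y z else checkLarge n x y z

check-large : ∀ n x y z → 500 ≤ n → T (check n x y z) → T (checkLarge n x y z)
check-large n x y z 500≤n h with n <ᵇ 500 in eq
... | false = h
... | true  = contradiction (<ᵇ⇒< n 500 (subst T (sym eq) tt)) (≤⇒≯ 500≤n)

Bounded : ℕ → ℕ → ℕ → ℕ → Set
Bounded n x y z = (y * y ≤ x * z) ⊎ ((x * z < y * y) × ((y * y ∸ x * z) ^ 2 * (24 * n) ^ 3 < (240 * (x * z)) ^ 2))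

check-small : ∀ n x y z → 6 < n → n < 500 → T (check n x y z) → Bounded n x y z
check-small n x y z 6<n n<500 h with n <ᵇ 500 in eq
... | false = contradiction (subst T eq (<⇒<ᵇ n<500)) λ ()
... | true with Equivalence.to (T-∨ {n ≤ᵇ 6}) h
...   | inj₁ n≤6 = contradiction (≤ᵇ⇒≤ n 6 n≤6) (<⇒≱ 6<n)
...   | inj₂ h′ with Equivalence.to (T-∨ {y * y ≤ᵇ x * z}) h′
...     | inj₁ le = inj₁ (≤ᵇ⇒≤ (y * y) (x * z) le)
...     | inj₂ gt with Equivalence.to (T-∧ {x * z <ᵇ y * y}) gt
...       | lt , bd = inj₂ (<ᵇ⇒< (x * z) (y * y) lt , <ᵇ⇒< _ _ bd)

-- The next value is an argument of `run′`, so that the soundness proof can replace the computed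
-- quotient by q(n+1).
run : ℕ → ℕ → List ℕ → ℕ → ℕ → List ℕ → Bool
run′ : ℕ → ℕ → List ℕ → ℕ → ℕ → List ℕ → ℕ → Bool
run zero n σs x y ps = true
run (suc f) n σs x y ps = run′ f n σs x y ps (dot σs ps 0 / suc n)
run′ f n σs x y ps z = check n x y z ∧ run f (suc n) σs y z (z ∷ ps)

∧-split : ∀ b {c} → b ∧ c ≡ true → T b × c ≡ true
∧-split true h = tt , h

module _ (q : ℕ → ℕ) (σ⋆q : ∀ n → n * q n ≡ (σ ⋆ q) n) where
  Checked : ℕ → Set
  Checked n = T (check (suc n) (q n) (q (suc n)) (q (suc (suc n))))

  -- Stated for any q with the recurrence, so that soundness is proved without evaluating `p`; the
  -- division is exact.
  dot-σ : ∀ n N → n < N → dot (applyUpTo (σ ∘ suc) N) (history q n) 0 / suc n ≡ q (suc n)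
  dot-σ n N n<N = trans (cong (_/ suc n) numerator) (m*n/n≡m (q (suc n)) (suc n))
    where
    numerator : dot (applyUpTo (σ ∘ suc) N) (history q n) 0 ≡ q (suc n) * suc n
    numerator = trans (dot-history (σ ∘ suc) q n N 0 n<N) (trans (+-identityʳ _)
      (trans (sym (⋆-suc σ q n)) (trans (sym (σ⋆q (suc n))) (*-comm (suc n) (q (suc n))))))

  run-sound : ∀ N f n → n + f < N →
    run f (suc n) (applyUpTo (σ ∘ suc) N) (q n) (q (suc n)) (history q (suc n)) ≡ true →
    ∀ i → i < f → Checked (n + i)
  run-sound N (suc f) n n+f<N h i i<f
    with ∧-split (check (suc n) (q n) (q (suc n)) (q (suc (suc n))))
           (subst (λ z → run′ f (suc n) (applyUpTo (σ ∘ suc) N) (q n) (q (suc n)) (history q (suc n)) z ≡ true) (dot-σ (suc n) N 1+n<N) h)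
    where
    1+n<N : suc n < N
    1+n<N = ≤-trans (s≤s (≤-trans (s≤s (m≤m+n n f)) (≤-reflexive (sym (+-suc n f))))) n+f<N
  run-sound N (suc f) n n+f<N h zero i<f | now , later = subst Checked (sym (+-identityʳ n)) now
  run-sound N (suc f) n n+f<N h (suc i) i<f | now , later =
    subst Checked (sym (+-suc n i)) (run-sound N f (suc n) (subst (_< N) (+-suc n f) n+f<N) later i (s≤s⁻¹ i<f))

  run-checked : ∀ N f → f < N → q 0 ≡ 1 → q 1 ≡ 1 → run f 1 (applyUpTo (σ ∘ suc) N) 1 1 (1 ∷ 1 ∷ []) ≡ true → ∀ n → n < f → Checked n
  run-checked N f f<N q₀ q₁ h = run-sound N f 0 f<N
    (trans (cong₂ (λ x y → run f 1 (applyUpTo (σ ∘ suc) N) x y (y ∷ x ∷ [])) q₀ q₁) h)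

table : run 1999 1 (applyUpTo (σ ∘ suc) 2000) 1 1 (1 ∷ 1 ∷ []) ≡ true
table = refl

checked : ∀ n → n < 1999 → T (check (suc n) (p n) (p (suc n)) (p (suc (suc n))))
checked = run-checked p n*p≡σ⋆p 2000 1999 (≤ᵇ⇒≤ 2000 2000 tt) refl refl table

-- The table allows a relative loss of 22/n², which is at most every admissible a/b because 22² ≤ n.
near-convex-small : ∀ n → 500 ≤ n → n < 2000 → NearConvex n
near-convex-small n@(suc n′) 500≤n n<2000 a b b²≤a²n³ with a ≤? b
... | no  a≰b = subst (λ d → CS (b * p n′) (d * p n) (b * p (suc n))) (sym (m≤n⇒m∸n≡0 (<⇒≤ (≰⇒> a≰b)))) (cs z≤n)
... | yes a≤b = cs (*-cancelˡ-≤ (N * N) (begin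
  N * N * ((b ∸ a) * p n * ((b ∸ a) * p n))        ≡⟨ eq₁ N (b ∸ a) (p n) ⟩
  N * (b ∸ a) * p n * (N * (b ∸ a) * p n)          ≤⟨ *-mono-≤ (*-monoˡ-≤ (p n) smaller) (*-monoˡ-≤ (p n) smaller) ⟩
  b * (N ∸ 22) * p n * (b * (N ∸ 22) * p n)        ≡⟨ eq₂ b (N ∸ 22) (p n) ⟩
  b * b * ((N ∸ 22) * p n * ((N ∸ 22) * p n))      ≤⟨ *-monoʳ-≤ (b * b) large ⟩
  b * b * (N * p n′ * (N * p (suc n)))             ≡⟨ eq₃ b N (p n′) (p (suc n)) ⟩
  N * N * (b * p n′ * (b * p (suc n)))             ∎))
  where
  open ≤-Reasoning
  N = n * n
  large : (N ∸ 22) * p n * ((N ∸ 22) * p n) ≤ N * p n′ * (N * p (suc n))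
  large = ≤ᵇ⇒≤ _ _ (check-large n (p n′) (p n) (p (suc n)) 500≤n (checked n′ (s≤s⁻¹ n<2000)))
  eq₁ : ∀ N d x → N * N * (d * x * (d * x)) ≡ N * d * x * (N * d * x)
  eq₁ = solve-∀
  eq₂ : ∀ b N x → b * N * x * (b * N * x) ≡ b * b * (N * x * (N * x))
  eq₂ = solve-∀
  eq₃ : ∀ b N x y → b * b * (N * x * (N * y)) ≡ N * N * (b * x * (b * y))
  eq₃ = solve-∀
  eq₄ : ∀ b → 22 * b * (22 * b) ≡ 484 * (b * b)
  eq₄ = solve-∀
  eq₅ : ∀ a n → n * (a * a * (n * n * n)) ≡ n * n * a * (n * n * a)
  eq₅ = solve-∀
  22b≤Na : 22 * b ≤ N * a
  22b≤Na = sq-cancel-≤ (begin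
    22 * b * (22 * b)              ≡⟨ eq₄ b ⟩
    484 * (b * b)                  ≤⟨ *-mono-≤ (≤-trans (≤ᵇ⇒≤ 484 500 tt) 500≤n) b²≤a²n³ ⟩
    n * (a * a * (n * n * n))      ≡⟨ eq₅ a n ⟩
    N * a * (N * a)                ∎)
  smaller : N * (b ∸ a) ≤ b * (N ∸ 22)
  smaller = begin
    N * (b ∸ a)          ≡⟨ *-distribˡ-∸ N b a ⟩
    N * b ∸ N * a        ≤⟨ ∸-monoʳ-≤ (N * b) 22b≤Na ⟩
    N * b ∸ 22 * b       ≡⟨ sym (*-distribʳ-∸ b N 22) ⟩
    (N ∸ 22) * b         ≡⟨ *-comm (N ∸ 22) b ⟩
    b * (N ∸ 22)         ∎

-- Closing the induction and deriving the stated inequality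

floor-sqrt : ∀ n → 0 < n → ∃ λ r → r * r < n × n ≤ suc r * suc r
floor-sqrt (suc zero) _ = 0 , ≤-refl , ≤-refl
floor-sqrt (suc n@(suc _)) _ with floor-sqrt n z<s
... | r , r²<n , n≤s² with suc n ≤? suc r * suc r
...   | yes n′≤s² = r , m<n⇒m<1+n r²<n , n′≤s²
...   | no  n′≰s² = suc r , ≰⇒> n′≰s² , ≤-trans (s≤s n≤s²) (*-mono-< (n<1+n (suc r)) (n<1+n (suc r)))

near-convex : ∀ n → 500 ≤ n → NearConvex n
near-convex n = go n n ≤-refl
  where
  go : ∀ bound n → n ≤ bound → 500 ≤ n → NearConvex n
  go bound n n≤bound 500≤n with n <? 2000
  ... | yes n<2000 = near-convex-small n 500≤n n<2000
  go (suc bound) (suc n′) (s≤s n′≤bound) 500≤n | no n≮2000 with floor-sqrt (suc n′) z<s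
  ... | r , r²<n , n≤s² = Step.conclusion n′ r 44≤r r²<n n≤s² 2000≤n
    -- 2000 = 4·500: the index j stays in the range of the statement.
    λ j j<n n≤4j → go bound j (≤-trans (s≤s⁻¹ j<n) n′≤bound) (*-cancelˡ-≤ 4 (≤-trans 2000≤n n≤4j))
    where
    2000≤n : 2000 ≤ suc n′
    2000≤n = ≮⇒≥ n≮2000
    44≤r : 44 ≤ r
    44≤r = ≮⇒≥ λ r<44 → <⇒≱ (≤-trans (s≤s (*-mono-≤ r<44 r<44)) (≤ᵇ⇒≤ 1937 2000 tt)) (≤-trans 2000≤n n≤s²)

-- From B/A ≤ f/e and f²/e² < v/u.
*-sq-< : ∀ e f u v {A B} → f * f * u < e * e * v → e * B ≤ f * A → 0 < B → u * (B * B) < v * (A * A)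
*-sq-< e f u v {A} {B} f²u<e²v eB≤fA B>0 = *-cancelˡ-< (f * f) _ _ (begin-strict
  f * f * (u * (B * B))    ≡⟨ sym (*-assoc (f * f) u (B * B)) ⟩
  f * f * u * (B * B)      <⟨ *-monoˡ-< (B * B) {{>-nonZero (*-mono-< B>0 B>0)}} f²u<e²v ⟩
  e * e * v * (B * B)      ≡⟨ eq e v B ⟩
  v * (e * B * (e * B))    ≤⟨ *-monoʳ-≤ v (*-mono-≤ eB≤fA eB≤fA) ⟩
  v * (f * A * (f * A))    ≡⟨ sym (eq f v A) ⟩
  f * f * v * (A * A)      ≡⟨ *-assoc (f * f) v (A * A) ⟩
  f * f * (v * (A * A))    ∎)
  where
  open ≤-Reasoning
  eq : ∀ e v B → e * e * v * (B * B) ≡ v * (e * B * (e * B))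
  eq = solve-∀

^-expand₃ : ∀ D n c {c³} → c * c * c ≡ c³ → D ^ 2 * (c * n) ^ 3 ≡ c³ * (n * n * n * (D * D))
^-expand₃ D n c refl = eq D n c
  where
  eq : ∀ D n c → D * (D * 1) * (c * n * (c * n * (c * n * 1))) ≡ c * c * c * (n * n * n * (D * D))
  eq = solve-∀

^-expand₂ : ∀ A c {c²} → c * c ≡ c² → (c * A) ^ 2 ≡ c² * (A * A)
^-expand₂ A c refl = eq A c
  where
  eq : ∀ A c → c * A * (c * A * 1) ≡ c * c * (A * A)
  eq = solve-∀

-- The constants 24³ and 240² enter as variables c and w to keep them from being unfolded.
-- The hypothesis is used with a/b = (⌊10√n⌋ + 1)/(10n²).
defect-bound : ∀ c w n x y z → 24 * 24 * 24 ≡ c → 240 * 240 ≡ w → 100 * 100 * (c * 101) < 99 * 99 * (25 * w) →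
  500 ≤ n → (∀ a b → b * b ≤ a * a * (n * n * n) → CS (b * x) ((b ∸ a) * y) (b * z)) →
  x * z < y * y → (y * y ∸ x * z) ^ 2 * (24 * n) ^ 3 < (240 * (x * z)) ^ 2
defect-bound c w n x y z c≡ w≡ numeric 500≤n near A<B = subst₂ _<_ (sym lhs≡) (sym rhs≡) (*-cancelˡ-< 25 _ _ (begin-strict
  25 * (c * (n * n * n * (D * D)))         ≡⟨ eq₁ c (n * n * n) (D * D) ⟩
  c * (25 * (n * n * n) * (D * D))         ≤⟨ *-monoʳ-≤ c 25n³D²≤101B² ⟩
  c * (101 * (B * B))                      ≡⟨ sym (*-assoc c 101 (B * B)) ⟩
  c * 101 * (B * B)                        <⟨ *-sq-< 99 100 (c * 101) (25 * w) {A} {B} numeric 99B≤100A (≤-trans (s≤s z≤n) A<B) ⟩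
  25 * w * (A * A)                         ≡⟨ *-assoc 25 w (A * A) ⟩
  25 * (w * (A * A))                       ∎))
  where
  open ≤-Reasoning
  instance
    n≢0 : NonZero n
    n≢0 = >-nonZero (≤-trans (≤ᵇ⇒≤ 1 500 tt) 500≤n)
  A = x * z
  B = y * y
  D = B ∸ A
  lhs≡ : D ^ 2 * (24 * n) ^ 3 ≡ c * (n * n * n * (D * D))
  lhs≡ = ^-expand₃ D n 24 c≡
  rhs≡ : (240 * A) ^ 2 ≡ w * (A * A)
  rhs≡ = ^-expand₂ A 240 w≡
  eq₁ : ∀ c N D → 25 * (c * (N * D)) ≡ c * (25 * N * D)
  eq₁ = solve-∀
  root = floor-sqrt (100 * n) (≤-trans (≤ᵇ⇒≤ 1 100 tt) (m≤m*n 100 n))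
  r = proj₁ root
  t = suc r
  r²<100n : r * r < 100 * n
  r²<100n = proj₁ (proj₂ root)
  100n≤t² : 100 * n ≤ t * t
  100n≤t² = proj₂ (proj₂ root)
  D+A≡B : D + A ≡ B
  D+A≡B = m∸n+n≡m (<⇒≤ A<B)
  -- Rounding 10√n up to an integer costs at most one percent in the square.
  t²≤101n : t * t ≤ 101 * n
  t²≤101n = begin
    suc r * suc r             ≡⟨ eq r ⟩
    suc (r * r) + 2 * r       ≤⟨ +-mono-≤ r²<100n 2r≤n ⟩
    100 * n + n               ≡⟨ +-comm (100 * n) n ⟩
    101 * n                   ∎
    where
    eq : ∀ r → suc r * suc r ≡ suc (r * r) + 2 * r
    eq = solve-∀
    eq′ : ∀ r → 2 * r * (2 * r) ≡ 4 * (r * r)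
    eq′ = solve-∀
    2r≤n : 2 * r ≤ n
    2r≤n = sq-cancel-≤ (begin
      2 * r * (2 * r)         ≡⟨ eq′ r ⟩
      4 * (r * r)             ≤⟨ *-monoʳ-≤ 4 (≤-trans (n≤1+n (r * r)) r²<100n) ⟩
      4 * (100 * n)           ≡⟨ sym (*-assoc 4 100 n) ⟩
      400 * n                 ≤⟨ *-monoˡ-≤ n (≤-trans (≤ᵇ⇒≤ 400 500 tt) 500≤n) ⟩
      n * n                   ∎)
  t≤n : t ≤ n
  t≤n = sq-cancel-≤ (≤-trans t²≤101n (*-monoˡ-≤ n (≤-trans (≤ᵇ⇒≤ 101 500 tt) 500≤n)))
  b = 10 * (n * n)
  b²≤t²n³ : b * b ≤ t * t * (n * n * n)
  b²≤t²n³ = begin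
    b * b                        ≡⟨ eq n ⟩
    100 * n * (n * n * n)        ≤⟨ *-monoˡ-≤ (n * n * n) 100n≤t² ⟩
    t * t * (n * n * n)          ∎
    where
    eq : ∀ n → 10 * (n * n) * (10 * (n * n)) ≡ 100 * n * (n * n * n)
    eq = solve-∀
  t≤b : t ≤ b
  t≤b = ≤-trans t≤n (≤-trans (m≤m*n n n) (m≤n*m (n * n) 10))
  bD≤2tB : b * D ≤ 2 * (t * B)
  -- With x = t/b, A ≥ (1-x)² B gives D ≤ (2x - x²) B; the term x² is dropped.
  bD≤2tB = +-cancelʳ-≤ (b * A) _ _ (*-cancelˡ-≤ b {{m*n≢0 10 (n * n) {{_}} {{m*n≢0 n n}}}} (begin
    b * (b * D + b * A)                         ≡⟨ cong (b *_) (trans (sym (*-distribˡ-+ b D A)) (cong (b *_) D+A≡B)) ⟩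
    b * (b * B)                                 ≤⟨ m≤m+n _ (t * t * B) ⟩
    b * (b * B) + t * t * B                     ≡⟨ cong (λ x → x * (x * B) + t * t * B) (sym (m∸n+n≡m t≤b)) ⟩
    (d + t) * ((d + t) * B) + t * t * B         ≡⟨ eq₃ d t y ⟩
    (d + t) * (2 * (t * B)) + d * y * (d * y) ≡⟨ cong (λ x → x * (2 * (t * B)) + d * y * (d * y)) (m∸n+n≡m t≤b) ⟩
    b * (2 * (t * B)) + d * y * (d * y)     ≤⟨ +-monoʳ-≤ (b * (2 * (t * B))) (CS.b²≤ac (near t b b²≤t²n³)) ⟩
    b * (2 * (t * B)) + b * x * (b * z)            ≡⟨ eq₄ b (2 * (t * B)) x z ⟩
    b * (2 * (t * B) + b * A)                   ∎))
    where
    d = b ∸ t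
    eq₃ : ∀ d t x → (d + t) * ((d + t) * (x * x)) + t * t * (x * x) ≡ (d + t) * (2 * (t * (x * x))) + d * x * (d * x)
    eq₃ = solve-∀
    eq₄ : ∀ b u x y → b * u + b * x * (b * y) ≡ b * (u + b * (x * y))
    eq₄ = solve-∀
  5n²D≤tB : 5 * (n * n) * D ≤ t * B
  5n²D≤tB = *-cancelˡ-≤ 2 (≤-trans (≤-reflexive (eq (n * n) D)) bD≤2tB)
    where
    eq : ∀ N D → 2 * (5 * N * D) ≡ 10 * N * D
    eq = solve-∀
  25n³D²≤101B² : 25 * (n * n * n) * (D * D) ≤ 101 * (B * B)
  25n³D²≤101B² = *-cancelˡ-≤ n (begin
    n * (25 * (n * n * n) * (D * D))        ≡⟨ eq n D ⟩
    5 * (n * n) * D * (5 * (n * n) * D)     ≤⟨ *-mono-≤ 5n²D≤tB 5n²D≤tB ⟩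
    t * B * (t * B)                         ≡⟨ eq′ t B ⟩
    t * t * (B * B)                         ≤⟨ *-monoˡ-≤ (B * B) t²≤101n ⟩
    101 * n * (B * B)                       ≡⟨ eq″ n (B * B) ⟩
    n * (101 * (B * B))                     ∎)
    where
    eq : ∀ n D → n * (25 * (n * n * n) * (D * D)) ≡ 5 * (n * n) * D * (5 * (n * n) * D)
    eq = solve-∀
    eq′ : ∀ t B → t * B * (t * B) ≡ t * t * (B * B)
    eq′ = solve-∀
    eq″ : ∀ n x → 101 * n * x ≡ n * (101 * x)
    eq″ = solve-∀
  100D≤B : 100 * D ≤ B
  100D≤B = *-cancelˡ-≤ n (begin
    n * (100 * D)        ≡⟨ eq n D ⟩
    5 * (n * 20) * D     ≤⟨ *-monoˡ-≤ D (*-monoʳ-≤ 5 (*-monoʳ-≤ n (≤-trans (≤ᵇ⇒≤ 20 500 tt) 500≤n))) ⟩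
    5 * (n * n) * D      ≤⟨ 5n²D≤tB ⟩
    t * B                ≤⟨ *-monoˡ-≤ B t≤n ⟩
    n * B                ∎)
    where
    eq : ∀ n D → n * (100 * D) ≡ 5 * (n * 20) * D
    eq = solve-∀
  -- The defect is bounded relative to B = p(n)², whereas the goal is relative to A = p(n-1) p(n+1).
  99B≤100A : 99 * B ≤ 100 * A
  99B≤100A = +-cancelˡ-≤ (100 * D) _ _ (begin
    100 * D + 99 * B     ≤⟨ +-monoˡ-≤ (99 * B) 100D≤B ⟩
    100 * B              ≡⟨ cong (100 *_) (sym D+A≡B) ⟩
    100 * (D + A)        ≡⟨ *-distribˡ-+ 100 D A ⟩
    100 * D + 100 * A    ∎)

bounded : ∀ n x y z → (x * z < y * y → (y * y ∸ x * z) ^ 2 * (24 * n) ^ 3 < (240 * (x * z)) ^ 2) → Bounded n x y z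
bounded n x y z h with y * y ≤? x * z
... | yes le = inj₁ le
... | no  gt = inj₂ (≰⇒> gt , h (≰⇒> gt))

-- If p(n)² ≤ p(n-1) p(n+1), the real inequality is immediate. Otherwise the truncated difference is
-- exact, and squaring removes the exponent 3/2.
theorem4p2 : ∀ (n : ℕ) → 6 < n →
    (p n * p n ≤ p (n ∸ 1) * p (suc n))
    ⊎ ((p (n ∸ 1) * p (suc n) < p n * p n)
    × ((p n * p n ∸ p (n ∸ 1) * p (suc n)) ^ 2 * (24 * n) ^ 3
    < (240 * (p (n ∸ 1) * p (suc n))) ^ 2))
theorem4p2 n@(suc n′) 6<n with n <? 500
... | yes n<500 = check-small n (p n′) (p n) (p (suc n)) 6<n n<500 (checked n′ (≤-trans (s≤s⁻¹ n<500) (≤ᵇ⇒≤ 499 1999 tt)))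
... | no  n≮500 = bounded n (p n′) (p n) (p (suc n))
  -- 24³ and 240². Their ratio exceeds what is required by about one percent after both roundings.
  (defect-bound 13824 57600 n (p n′) (p n) (p (suc n)) refl refl (≤ᵇ⇒≤ (suc (100 * 100 * (13824 * 101))) (99 * 99 * (25 * 57600)) tt)
    (≮⇒≥ n≮500) (near-convex n (≮⇒≥ n≮500)))
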